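{- Let $G$ be a difference graph with Young matrix $Y$ having $h$ rows, and let $r_1,r_2,\ldots,r_h$ be the row sums of $Y$. Then $$\mathbf{a}_4(G)=\sum_{i=1}^{h-1}\sum_{j=i+1}^{h}(r_i-r_{i+1})\, i\, r_j.$$
   Context: All graphs are finite, simple and undirected. For a graph $G$ on $n$ vertices with adjacency matrix $\mathbf{A}(G)$, write $\det(\lambda I-\mathbf{A}(G))=\sum_{i=0}^n \mathbf{a}_i(G)\lambda^{n-i}$, so $\mathbf{a}_4(G)$ is the coefficient of $\lambda^{n-4}$. A difference graph with vertex bipartition $(X_1,\ldots,X_k;Y_1,\ldots,Y_k)$ is a graph whose vertex set is the disjoint union of nonempty sets $X_1,\ldots,X_k,Y_1,\ldots,Y_k$ in which $x\in X_i$ and $y\in Y_j$ are adjacent if and only if $i+j\le k+1$, with no other edges. Its Young matrix $Y$ has rows indexed by the vertices of $X$ listed as all vertices of $X_1$, then $X_2$, ..., then $X_k$, and columns indexed by the vertices of $Y$ listed as all of $Y_1$, then $Y_2$, ..., then $Y_k$; an entry is $1$ if the corresponding vertices are adjacent and $0$ otherwise (so $r_1\ge r_2\ge\cdots\ge r_h$). -}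

module Defs where

open import Data.Bool using (Bool; true; false; if_then_else_; _∧_; _∨_)
open import Data.Nat as ℕ using (ℕ; zero; suc; _∸_; _<ᵇ_; _≤ᵇ_)
open import Data.Integer as ℤ using (ℤ; +_; -_; _+_; _*_; _-_)
open import Data.Fin as Fin using (Fin; toℕ; punchIn)
open import Data.Fin.Properties using () renaming (_≟_ to _≟F_)
open import Data.List as List using (List; []; _∷_; map; foldr; length; filterᵇ; concatMap; allFin; upTo)
import Data.Nat.ListAction as ListAction
open import Data.Sum using (_⊎_; inj₁; inj₂)
open import Relation.Nullary.Decidable using (⌊_⌋)

-- Polynomials over ℤ as coefficient lists (lowest degree first)

Poly : Set
Poly = List ℤ

infixl 6 _+ₚ_
infixl 7 _*ₚ_

_+ₚ_ : Poly → Poly → Poly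
[] +ₚ q = q
(a ∷ p) +ₚ [] = a ∷ p
(a ∷ p) +ₚ (b ∷ q) = (a + b) ∷ (p +ₚ q)

scaleₚ : ℤ → Poly → Poly
scaleₚ c p = map (c *_) p

_*ₚ_ : Poly → Poly → Poly
[] *ₚ q = []
(a ∷ p) *ₚ q = scaleₚ a q +ₚ (+ 0 ∷ (p *ₚ q))

coeff : ℕ → Poly → ℤ
coeff _ [] = + 0
coeff zero (a ∷ p) = a
coeff (suc d) (a ∷ p) = coeff d p

sumₚ : List Poly → Poly
sumₚ = foldr _+ₚ_ []

det : (n : ℕ) → (Fin n → Fin n → Poly) → Poly
det zero M = + 1 ∷ []
det (suc n) M =
  sumₚ (map (λ j → scaleₚ ((- + 1) ℤ.^ toℕ j)
                     (M Fin.zero j *ₚ det n (λ i l → M (Fin.suc i) (punchIn j l))))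
            (allFin (suc n)))

adjMatrix : (n : ℕ) → (Fin n → Fin n → Bool) → Fin n → Fin n → ℤ
adjMatrix n adj u v = if adj u v then + 1 else + 0

charPoly : (n : ℕ) → (Fin n → Fin n → Bool) → Poly
charPoly n adj =
  det n (λ u v → if ⌊ u ≟F v ⌋
                   then (- adjMatrix n adj u v) ∷ + 1 ∷ []
                   else (- adjMatrix n adj u v) ∷ [])

-- a_i(G) = coefficient of λ^(n-i) in det(λI - A(G)), for 0 ≤ i ≤ n
-- (and 0 for i > n, as the polynomial has no such term)
coeffA : ℕ → (n : ℕ) → (Fin n → Fin n → Bool) → ℤ
coeffA i n adj = if i ≤ᵇ n then coeff (n ∸ i) (charPoly n adj) else + 0

-- Difference graphs.
-- Vertex set Fin n; `part v = inj₁ i` means v ∈ X_{i+1},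
-- `part v = inj₂ j` means v ∈ Y_{j+1} (0-based Fin indices).

-- x ∈ X_i, y ∈ Y_j adjacent iff i + j ≤ k + 1 (1-based),
-- i.e. toℕ i + toℕ j < k (0-based)
diffAdj : (k n : ℕ) → (Fin n → Fin k ⊎ Fin k) → Fin n → Fin n → Bool
diffAdj k n part u v with part u | part v
... | inj₁ i | inj₂ j = (toℕ i ℕ.+ toℕ j) <ᵇ k
... | inj₂ j | inj₁ i = (toℕ i ℕ.+ toℕ j) <ᵇ k
... | _      | _      = false

inBlockX : {k : ℕ} → Fin k → Fin k ⊎ Fin k → Bool
inBlockX i (inj₁ i') = ⌊ i ≟F i' ⌋
inBlockX i (inj₂ _) = false

inBlockY : {k : ℕ} → Fin k → Fin k ⊎ Fin k → Bool
inBlockY j (inj₁ _) = false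
inBlockY j (inj₂ j') = ⌊ j ≟F j' ⌋

xList : (k n : ℕ) → (Fin n → Fin k ⊎ Fin k) → List (Fin n)
xList k n part = concatMap (λ i → filterᵇ (λ v → inBlockX i (part v)) (allFin n)) (allFin k)

yList : (k n : ℕ) → (Fin n → Fin k ⊎ Fin k) → List (Fin n)
yList k n part = concatMap (λ j → filterᵇ (λ v → inBlockY j (part v)) (allFin n)) (allFin k)

youngMatrix : (k n : ℕ) → (Fin n → Fin k ⊎ Fin k) → List (List ℕ)
youngMatrix k n part =
  map (λ x → map (λ y → if diffAdj k n part x y then 1 else 0) (yList k n part))
      (xList k n part)

rowSums : (k n : ℕ) → (Fin n → Fin k ⊎ Fin k) → List ℕ
rowSums k n part = map ListAction.sum (youngMatrix k n part)

-- 1-based lookup with default 0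
at : List ℕ → ℕ → ℕ
at [] _ = 0
at (a ∷ as) zero = 0
at (a ∷ as) (suc zero) = a
at (a ∷ as) (suc (suc t)) = at as (suc t)

-- Σ_{i=a}^{b} f i   (empty if b < a)
sumFromTo : ℕ → ℕ → (ℕ → ℤ) → ℤ
sumFromTo a b f = List.foldr _+_ (+ 0) (map (λ t → f (a ℕ.+ t)) (upTo (suc b ∸ a)))

youngSum : List ℕ → ℤ
youngSum r =
  sumFromTo 1 (h ∸ 1) (λ i →
    sumFromTo (suc i) h (λ j →
      ((+ at r i) - (+ at r (suc i))) * (+ i) * (+ at r j)))
  where h = length r

{-# OPTIONS --safe #-}

-- By multilinearity in the rows, the coefficient of λ^(n-4) in det(λI - A) is the sum of the
-- 4 × 4 principal minors of -A.  Such a minor is a symmetric function of its four vertices that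
-- vanishes when two of them coincide, so 24 a₄ is the sum over all 4-tuples of vertices, which
-- expands to 3 (tr A²)² - 6 tr A⁴.  For a bipartite graph tr A² is twice the sum of the degrees
-- r_x over x ∈ X, and tr A⁴ is twice the sum of the squares of the numbers of common
-- neighbours of x, x′ ∈ X.  In a difference graph neighbourhoods are nested, so these numbers are
-- the smaller degrees, and a₄ = Σ_{i<j} (r_i r_j - r_j²).  Summation by parts gives the formula.
module Submission where

open import Defs
open import Data.Nat using (ℕ; _≤_)
open import Data.Fin using (Fin)
open import Data.Sum using (_⊎_)
open import Data.List using (length)
open import Data.Product using (∃)
open import Relation.Binary.PropositionalEquality using (_≡_)

open import Data.Bool using (Bool; true; false; if_then_else_; _∧_; T)
open import Data.Bool.Properties using (T?)
open import Data.Fin as Fin using (toℕ; punchIn)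
open import Data.Fin.Properties using (_≟_)
open import Data.Integer using (ℤ; +_; -_; _+_; _*_; _-_; _^_)
open import Data.Integer using () renaming (+_ to pos)
open import Data.Integer.Properties
  using (+-identityˡ; +-identityʳ; +-assoc; *-zeroˡ; *-zeroʳ; *-identityˡ; *-assoc; *-comm;
         *-distribˡ-+; *-distribʳ-+; pos-*; *-cancelˡ-≡)
open import Data.Integer.Tactic.RingSolver using (solve-∀)
open import Data.List
  using (List; []; _∷_; _++_; map; foldr; tabulate; allFin; [_]; applyUpTo; concatMap; filterᵇ)
open import Data.List.Properties
  using (map-tabulate; map-++; map-∘; ++-assoc; ++-identityʳ; length-tabulate)
open import Data.List.Relation.Unary.All as All using (All; []; _∷_)
import Data.List.Relation.Unary.All.Properties as Allₚ
open import Data.List.Relation.Unary.AllPairs as AllPairs using (AllPairs; []; _∷_)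
import Data.List.Relation.Unary.AllPairs.Properties as AllPairsₚ
open import Data.List.Relation.Unary.Unique.Propositional using (Unique)
open import Data.List.Relation.Unary.Unique.Propositional.Properties using (allFin⁺)
open import Data.Nat as ℕ using (zero; suc; _∸_; _<ᵇ_; _≤ᵇ_; _!)
import Data.Nat.ListAction as ListAction
import Data.Nat.Properties as ℕₚ
open import Data.Product using (_×_; _,_)
open import Data.Sum using (inj₁; inj₂)
open import Data.Unit using (⊤; tt)
open import Data.Vec as Vec using (Vec; []; _∷_)
open import Function using (_∘_; id)
open import Relation.Binary.PropositionalEquality
  using (_≢_; refl; sym; trans; cong; cong₂; subst; module ≡-Reasoning)
open import Relation.Nullary using (yes; no; contradiction)
open import Relation.Nullary.Decidable using (⌊_⌋)

-- `det` deletes columns by renumbering with `punchIn`, which hides which entries were once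
-- diagonal. Rows and columns are therefore named by vertices and kept in lists, and a mark on each
-- row records whether its diagonal entry still carries λ. Linearity is needed in a row in the
-- middle of the matrix, while the determinant is only given by expansion along its first row. It is
-- proved by induction on the rows above, with explicit signs, so that no theory of permutations or
-- of alternating forms enters. Principal minors are indexed by subsets and traces by tuples. The
-- bridge is that a hollow symmetric 4 × 4 determinant is a symmetric polynomial in the three
-- products over perfect matchings. Over all tuples the summation variables may be renamed freely,
-- so every square of a matching product has the same sum, and every mixed product becomes a closed
-- walk of length four.

private variable
  A B : Set

-- Finite sums

∑ : List A → (A → ℤ) → ℤ
∑ []       f = + 0
∑ (x ∷ xs) f = f x + ∑ xs f

∑-cong : ∀ (xs : List A) {f g : A → ℤ} → (∀ x → f x ≡ g x) → ∑ xs f ≡ ∑ xs g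
∑-cong []       h = refl
∑-cong (x ∷ xs) h = cong₂ _+_ (h x) (∑-cong xs h)

∑-+ : ∀ (xs : List A) (f g : A → ℤ) → ∑ xs (λ x → f x + g x) ≡ ∑ xs f + ∑ xs g
∑-+ []       f g = refl
∑-+ (x ∷ xs) f g = trans (cong (_+_ (f x + g x)) (∑-+ xs f g)) (interchange (f x) (g x) _ _)
  where
  interchange : ∀ a b c d → a + b + (c + d) ≡ a + c + (b + d)
  interchange = solve-∀

∑-*ˡ : ∀ (xs : List A) (c : ℤ) (f : A → ℤ) → ∑ xs (λ x → c * f x) ≡ c * ∑ xs f
∑-*ˡ []       c f = sym (*-zeroʳ c)
∑-*ˡ (x ∷ xs) c f = trans (cong (_+_ (c * f x)) (∑-*ˡ xs c f)) (sym (*-distribˡ-+ c (f x) _))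

∑-*ʳ : ∀ (xs : List A) (f : A → ℤ) (c : ℤ) → ∑ xs (λ x → f x * c) ≡ ∑ xs f * c
∑-*ʳ []       f c = refl
∑-*ʳ (x ∷ xs) f c = trans (cong (_+_ (f x * c)) (∑-*ʳ xs f c)) (sym (*-distribʳ-+ c (f x) _))

∑-zero : ∀ (xs : List A) {f : A → ℤ} → (∀ x → f x ≡ + 0) → ∑ xs f ≡ + 0
∑-zero []       h = refl
∑-zero (x ∷ xs) h = cong₂ _+_ (h x) (∑-zero xs h)

∑-swap : ∀ (xs : List A) (ys : List B) (f : A → B → ℤ) →
         ∑ xs (λ x → ∑ ys (f x)) ≡ ∑ ys (λ y → ∑ xs (λ x → f x y))
∑-swap []       ys f = sym (∑-zero ys λ _ → refl)
∑-swap (x ∷ xs) ys f =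
  trans (cong (_+_ (∑ ys (f x))) (∑-swap xs ys f)) (sym (∑-+ ys (f x) _))

∑-map : ∀ (g : A → B) (xs : List A) (f : B → ℤ) → ∑ (map g xs) f ≡ ∑ xs (f ∘ g)
∑-map g []       f = refl
∑-map g (x ∷ xs) f = cong (_+_ (f (g x))) (∑-map g xs f)

∑-++ : ∀ (xs ys : List A) (f : A → ℤ) → ∑ (xs ++ ys) f ≡ ∑ xs f + ∑ ys f
∑-++ []       ys f = sym (+-identityˡ _)
∑-++ (x ∷ xs) ys f = trans (cong (_+_ (f x)) (∑-++ xs ys f)) (sym (+-assoc (f x) _ _))

-- Laplace expansion over lists of columns

-- Expansion along a first row whose columns are listed: the sum runs over the
-- ways of removing one element from the list, with alternating signs.
altSum : (A → List A → ℤ) → List A → ℤ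
altSum f []       = + 0
altSum f (x ∷ xs) = f x xs - altSum (λ y ys → f y (x ∷ ys)) xs

altSum-cong-All : ∀ {P : A → Set} {f g : A → List A → ℤ} {xs} → All P xs →
                  (∀ y {ys} → P y → All P ys → f y ys ≡ g y ys) → altSum f xs ≡ altSum g xs
altSum-cong-All []         h = refl
altSum-cong-All (px ∷ pxs) h =
  cong₂ _-_ (h _ px pxs) (altSum-cong-All pxs λ y py pys → h y py (px ∷ pys))

altSum-cong : ∀ (xs : List A) {f g : A → List A → ℤ} →
              (∀ y ys → f y ys ≡ g y ys) → altSum f xs ≡ altSum g xs
altSum-cong []       h = refl
altSum-cong (x ∷ xs) h = cong₂ _-_ (h x xs) (altSum-cong xs λ y ys → h y (x ∷ ys))

altSum-zero : ∀ (xs : List A) {f : A → List A → ℤ} →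
              (∀ y ys → f y ys ≡ + 0) → altSum f xs ≡ + 0
altSum-zero []       h = refl
altSum-zero (x ∷ xs) h = cong₂ _-_ (h x xs) (altSum-zero xs λ y ys → h y (x ∷ ys))

altSum-+* : ∀ (xs : List A) (f g : A → List A → ℤ) (s : ℤ) →
            altSum (λ y ys → f y ys + s * g y ys) xs ≡ altSum f xs + s * altSum g xs
altSum-+* []       f g s = sym (trans (+-identityˡ _) (*-zeroʳ s))
altSum-+* (x ∷ xs) f g s =
  trans (cong (_-_ (f x xs + s * g x xs)) (altSum-+* xs _ _ s)) (regroup (f x xs) _ s _ _)
  where
  regroup : ∀ a b s c d → a + s * b - (c + s * d) ≡ a - c + s * (b - d)
  regroup = solve-∀

sgn : List A → ℤ
sgn []       = + 1
sgn (_ ∷ xs) = - sgn xs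

private
  head-case : ∀ a b c → a - b ≡ c - b + + 1 * (a - c)
  head-case = solve-∀

  tail-case : ∀ a b s d → a - (b + s * d) ≡ a - b + - s * d
  tail-case = solve-∀

-- Only the term that removes `v` can differ, and its sign is given by the position of `v`, that is
-- by `sgn xs`.
altSum-update : ∀ {v : A} xs {ys} (f g : A → List A → ℤ) → All (v ≢_) xs → All (v ≢_) ys →
                (∀ y zs → v ≢ y → f y zs ≡ g y zs) →
                altSum f (xs ++ v ∷ ys) ≡
                altSum g (xs ++ v ∷ ys) + sgn xs * (f v (xs ++ ys) - g v (xs ++ ys))
altSum-update {v = v} [] {ys} f g [] v∉ys h =
  trans (cong (_-_ (f v ys)) (altSum-cong-All v∉ys λ y v≢y _ → h y _ v≢y)) (head-case (f v ys) _ (g v ys))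
altSum-update (x ∷ xs) f g (v≢x ∷ v∉xs) v∉ys h =
  trans (cong₂ _-_ (h x _ v≢x) (altSum-update xs _ _ v∉xs v∉ys λ y zs → h y (x ∷ zs)))
        (tail-case (g x _) _ (sgn xs) _)

-- The sign rule for expanding along two rows. If `y` stands before `v`, its removal moves `v` one
-- place forward; if `y` stands after `v`, the removal of `v` moves `y` one place forward. Either
-- way exactly one sign flips, hence `- s`.
altSum-transfer : ∀ {v : A} xs {ys} (f g k : A → List A → ℤ) (s : ℤ) →
                  All (v ≢_) xs → All (v ≢_) ys →
                  f v (xs ++ ys) ≡ g v (xs ++ ys) →
                  (∀ y us {ws} → v ≢ y → All (v ≢_) us → All (v ≢_) ws →
                    f y (us ++ v ∷ ws) ≡ g y (us ++ v ∷ ws) + s * sgn us * k y (us ++ ws)) →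
                  altSum f (xs ++ v ∷ ys) ≡
                  altSum g (xs ++ v ∷ ys) + - s * sgn xs * altSum k (xs ++ ys)
altSum-transfer {v = v} [] {ys} f g k s [] v∉ys hv h =
  trans (cong₂ _-_ hv (trans (altSum-cong-All v∉ys λ y v≢y v∉zs → h y [] v≢y [] v∉zs)
                             (altSum-+* ys _ _ (s * + 1))))
        (regroup (g v ys) _ s _)
  where
  regroup : ∀ a b s c → a - (b + s * + 1 * c) ≡ a - b + - s * + 1 * c
  regroup = solve-∀
altSum-transfer {v = v} (x ∷ xs) {ys} f g k s (v≢x ∷ v∉xs) v∉ys hv h =
  trans (cong₂ _-_ (h x xs v≢x v∉xs v∉ys)
          -- In the recursive call every list `us` is really `x ∷ us`; the extra sign is absorbed
          -- into `- s`.
          (altSum-transfer xs _ (λ y zs → g y (x ∷ zs)) (λ y zs → k y (x ∷ zs)) (- s) v∉xs v∉ys hv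
             λ y us {ws} v≢y v∉us v∉ws →
               trans (h y (x ∷ us) v≢y (v≢x ∷ v∉us) v∉ws)
                     (cong (λ t → g y (x ∷ us ++ v ∷ ws) + t * k y (x ∷ us ++ ws)) (neg s (sgn us)))))
        (regroup (g x (xs ++ v ∷ ys)) s (sgn xs) (k x (xs ++ ys)) _ _)
  where
  neg : ∀ s t → s * - t ≡ - s * t
  neg = solve-∀
  regroup : ∀ a s t b c d → a + s * t * b - (c + - (- s) * t * d) ≡ a - c + - s * - t * (b - d)
  regroup = solve-∀

-- Precomposition with `punchIn j` skips entry `j`, so the tabulated list is the one with that
-- column removed. This is where the indices of `det` are traded for lists.
∑-punchIn : ∀ {n} (h : A → List A → ℤ) (γ : Fin (suc n) → A) →
            ∑ (allFin (suc n)) (λ j → (- + 1) ^ toℕ j * h (γ j) (tabulate (γ ∘ punchIn j))) ≡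
            altSum h (tabulate γ)
∑-punchIn {n = n} h γ = cong₂ _+_ (*-identityˡ (h (γ Fin.zero) _)) (rest n h γ)
  where
  sign-out : ∀ s x → - + 1 * s * x ≡ - + 1 * (s * x)
  sign-out = solve-∀
  neg : ∀ x → - + 1 * x ≡ - x
  neg = solve-∀
  rest : ∀ n (h : _ → List _ → ℤ) (γ : Fin (suc n) → _) →
         ∑ (tabulate Fin.suc) (λ j → (- + 1) ^ toℕ j * h (γ j) (tabulate (γ ∘ punchIn j))) ≡
         - altSum (λ y ys → h y (γ Fin.zero ∷ ys)) (tabulate (γ ∘ Fin.suc))
  rest zero    h γ = refl
  rest (suc n) h γ = begin
    ∑ (tabulate Fin.suc) F
      ≡⟨ cong (λ l → ∑ l F) (sym (map-tabulate id Fin.suc)) ⟩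
    ∑ (map Fin.suc (allFin (suc n))) F
      ≡⟨ ∑-map Fin.suc (allFin (suc n)) F ⟩
    ∑ (allFin (suc n)) (F ∘ Fin.suc)
      ≡⟨ ∑-cong (allFin (suc n)) (λ j → sign-out ((- + 1) ^ toℕ j) (h′ (γ′ j) (tabulate (γ′ ∘ punchIn j)))) ⟩
    ∑ (allFin (suc n)) (λ j → - + 1 * ((- + 1) ^ toℕ j * h′ (γ′ j) (tabulate (γ′ ∘ punchIn j))))
      ≡⟨ ∑-*ˡ (allFin (suc n)) (- + 1) (λ j → (- + 1) ^ toℕ j * h′ (γ′ j) (tabulate (γ′ ∘ punchIn j))) ⟩
    - + 1 * ∑ (allFin (suc n)) (λ j → (- + 1) ^ toℕ j * h′ (γ′ j) (tabulate (γ′ ∘ punchIn j)))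
      ≡⟨ neg _ ⟩
    - ∑ (allFin (suc n)) (λ j → (- + 1) ^ toℕ j * h′ (γ′ j) (tabulate (γ′ ∘ punchIn j)))
      ≡⟨ cong -_ (cong₂ _+_ (*-identityˡ (h′ (γ′ Fin.zero) _)) (rest n h′ γ′)) ⟩
    - altSum h′ (tabulate γ′) ∎
    where
    open ≡-Reasoning
    F : Fin (suc (suc n)) → ℤ
    F j = (- + 1) ^ toℕ j * h (γ j) (tabulate (γ ∘ punchIn j))
    h′ : _ → List _ → ℤ
    h′ y ys = h y (γ Fin.zero ∷ ys)
    γ′ : Fin (suc n) → _
    γ′ = γ ∘ Fin.suc

-- Multiplication by λ, on coefficient sequences.
shift : (ℕ → ℤ) → ℕ → ℤ
shift f zero    = + 0
shift f (suc d) = f d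

-- Coefficients of the characteristic polynomial as sums of principal minors

coeff-+ₚ : ∀ d p q → coeff d (p +ₚ q) ≡ coeff d p + coeff d q
coeff-+ₚ d       []      q       = sym (+-identityˡ _)
coeff-+ₚ zero    (a ∷ p) []      = sym (+-identityʳ _)
coeff-+ₚ (suc d) (a ∷ p) []      = sym (+-identityʳ _)
coeff-+ₚ zero    (a ∷ p) (b ∷ q) = refl
coeff-+ₚ (suc d) (a ∷ p) (b ∷ q) = coeff-+ₚ d p q

coeff-scaleₚ : ∀ d c p → coeff d (scaleₚ c p) ≡ c * coeff d p
coeff-scaleₚ d       c []      = sym (*-zeroʳ c)
coeff-scaleₚ zero    c (a ∷ p) = refl
coeff-scaleₚ (suc d) c (a ∷ p) = coeff-scaleₚ d c p

coeff-sumₚ : ∀ d (f : A → Poly) xs → coeff d (sumₚ (map f xs)) ≡ ∑ xs (λ x → coeff d (f x))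
coeff-sumₚ d f []       = refl
coeff-sumₚ d f (x ∷ xs) = trans (coeff-+ₚ d (f x) _) (cong (_+_ (coeff d (f x))) (coeff-sumₚ d f xs))

coeff-const : ∀ a q d → coeff d ((a ∷ []) *ₚ q) ≡ a * coeff d q
coeff-const a q d =
  trans (coeff-+ₚ d (scaleₚ a q) _)
        (trans (cong₂ _+_ (coeff-scaleₚ d a q) (zero-poly d)) (+-identityʳ _))
  where
  zero-poly : ∀ d → coeff d (+ 0 ∷ []) ≡ + 0
  zero-poly zero    = refl
  zero-poly (suc d) = refl

coeff-monic-linear : ∀ a q d →
                     coeff d ((a ∷ + 1 ∷ []) *ₚ q) ≡ a * coeff d q + shift (λ d → coeff d q) d
coeff-monic-linear a q d =
  trans (coeff-+ₚ d (scaleₚ a q) _) (cong₂ _+_ (coeff-scaleₚ d a q) (shifted d))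
  where
  shifted : ∀ d → coeff d (+ 0 ∷ ((+ 1 ∷ []) *ₚ q)) ≡ shift (λ d → coeff d q) d
  shifted zero    = refl
  shifted (suc d) = trans (coeff-const (+ 1) q d) (*-identityˡ _)

-- Sublists are chosen by position and keep the order of the list; for a list of distinct vertices
-- they stand for the `t`-element subsets.
choose : (t : ℕ) → (Vec A t → ℤ) → List A → ℤ
choose zero    g xs       = g []
choose (suc t) g []       = + 0
choose (suc t) g (x ∷ xs) = choose t (g ∘ (x ∷_)) xs + choose (suc t) g xs

choose-cong : ∀ t {f g : Vec A t → ℤ} xs → (∀ v → f v ≡ g v) → choose t f xs ≡ choose t g xs
choose-cong zero    xs       h = h []
choose-cong (suc t) []       h = refl
choose-cong (suc t) (x ∷ xs) h = cong₂ _+_ (choose-cong t xs (h ∘ (x ∷_))) (choose-cong (suc t) xs h)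

choose-short : ∀ t (g : Vec A t → ℤ) xs → length xs ℕ.< t → choose t g xs ≡ + 0
choose-short (suc t) g []       _          = refl
choose-short (suc t) g (x ∷ xs) (ℕ.s≤s lt) =
  cong₂ _+_ (choose-short t _ xs lt) (choose-short (suc t) g xs (ℕₚ.m<n⇒m<1+n lt))

module Minors {N : ℕ} (e : Fin N → Fin N → ℤ) where

  V Row : Set
  V   = Fin N
  Row = V × Bool

  marked unmarked : V → Row
  marked v   = v , true
  unmarked v = v , false

  linear : Row → V → ℤ
  linear (u , b) v = if b ∧ ⌊ u ≟ v ⌋ then + 1 else + 0

  -- D rows cols d is the coefficient of λ^d in the determinant whose entry in row (u , b) and
  -- column v is e u v, plus λ if the row is marked (b = true) and u = v.
  D : List Row → List V → ℕ → ℤ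
  D []            cs zero    = + 1
  D []            cs (suc d) = + 0
  D ((u , b) ∷ R) cs d       =
    altSum (λ c l → e u c * D R l d + linear (u , b) c * shift (D R l) d) cs

  -- Row labels `ρ` and column labels `γ` are separate because an expansion step drops the first row
  -- but an arbitrary column. An entry carries λ exactly when its two labels agree, and this
  -- survives the deletions.
  det-coeff : ∀ n (M : Fin n → Fin n → Poly) (ρ γ : Fin n → V) →
              (∀ i j → M i j ≡ (if ⌊ ρ i ≟ γ j ⌋ then e (ρ i) (γ j) ∷ + 1 ∷ []
                                                 else e (ρ i) (γ j) ∷ [])) →
              ∀ d → coeff d (det n M) ≡ D (tabulate (marked ∘ ρ)) (tabulate γ) d
  det-coeff zero    M ρ γ h zero    = refl
  det-coeff zero    M ρ γ h (suc d) = refl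
  det-coeff (suc n) M ρ γ h d =
    trans (coeff-sumₚ d (λ j → scaleₚ ((- + 1) ^ toℕ j) (M Fin.zero j *ₚ sub j)) (allFin (suc n)))
      (trans (∑-cong (allFin (suc n)) λ j →
                trans (coeff-scaleₚ d ((- + 1) ^ toℕ j) (M Fin.zero j *ₚ sub j)) (cong ((- + 1) ^ toℕ j *_) (entry j)))
             (∑-punchIn (λ c l → e u c * D R l d + linear (marked u) c * shift (D R l) d) γ))
    where
    u = ρ Fin.zero
    R = tabulate (marked ∘ ρ ∘ Fin.suc)
    sub : Fin (suc n) → Poly
    sub j = det n (λ i l → M (Fin.suc i) (punchIn j l))
    IH : ∀ j d → coeff d (sub j) ≡ D R (tabulate (γ ∘ punchIn j)) d
    IH j = det-coeff n _ (ρ ∘ Fin.suc) (γ ∘ punchIn j) (λ i l → h (Fin.suc i) (punchIn j l))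
    shift-IH : ∀ j d → shift (λ d → coeff d (sub j)) d ≡ shift (D R (tabulate (γ ∘ punchIn j))) d
    shift-IH j zero    = refl
    shift-IH j (suc d) = IH j d
    entry : ∀ j → coeff d (M Fin.zero j *ₚ sub j) ≡
                  e u (γ j) * D R (tabulate (γ ∘ punchIn j)) d
                  + linear (marked u) (γ j) * shift (D R (tabulate (γ ∘ punchIn j))) d
    entry j rewrite h Fin.zero j with ⌊ u ≟ γ j ⌋
    ... | true  = trans (coeff-monic-linear (e u (γ j)) (sub j) d)
                    (cong₂ _+_ (cong (e u (γ j) *_) (IH j d)) (trans (shift-IH j d) (sym (*-identityˡ _))))
    ... | false = trans (coeff-const (e u (γ j)) (sub j) d)
                    (trans (cong (e u (γ j) *_) (IH j d))
                           (sym (trans (cong (_+_ (e u (γ j) * D R (tabulate (γ ∘ punchIn j)) d))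
                                             (*-zeroˡ (shift (D R (tabulate (γ ∘ punchIn j))) d)))
                                       (+-identityʳ _))))

  linear-≢ : ∀ {v c} → v ≢ c → linear (marked v) c ≡ + 0
  linear-≢ {v} {c} v≢c with v ≟ c
  ... | yes p = contradiction p v≢c
  ... | no  _ = refl

  linear-≡ : ∀ v → linear (marked v) v ≡ + 1
  linear-≡ v with v ≟ v
  ... | yes _ = refl
  ... | no  p = contradiction refl p

  -- The mark of row `v` acts only in column `v`, which is absent here.
  D-unmark : ∀ R₁ {R₂ v cs} d → All (v ≢_) cs →
             D (R₁ ++ marked v ∷ R₂) cs d ≡ D (R₁ ++ unmarked v ∷ R₂) cs d
  shift-D-unmark : ∀ R₁ {R₂ v cs} d → All (v ≢_) cs →
                   shift (D (R₁ ++ marked v ∷ R₂) cs) d ≡ shift (D (R₁ ++ unmarked v ∷ R₂) cs) d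
  D-unmark []       {R₂} {v} d v∉cs =
    altSum-cong-All v∉cs λ c {l} v≢c _ →
      cong (λ t → e v c * D R₂ l d + t * shift (D R₂ l) d) (linear-≢ v≢c)
  D-unmark (r@(u , _) ∷ R₁) d v∉cs =
    altSum-cong-All v∉cs λ c _ v∉l →
      cong₂ _+_ (cong (e u c *_) (D-unmark R₁ d v∉l)) (cong (linear r c *_) (shift-D-unmark R₁ d v∉l))
  shift-D-unmark R₁ zero    v∉cs = refl
  shift-D-unmark R₁ (suc d) v∉cs = D-unmark R₁ d v∉cs

  -- Linearity in the row of v, followed by the expansion along the row λ e_v.
  D-split : ∀ R₁ {R₂ v} cs {cs′} d → All (v ≢_) cs → All (v ≢_) cs′ →
            D (R₁ ++ marked v ∷ R₂) (cs ++ v ∷ cs′) d ≡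
            D (R₁ ++ unmarked v ∷ R₂) (cs ++ v ∷ cs′) d
            + sgn R₁ * sgn cs * shift (D (R₁ ++ R₂) (cs ++ cs′)) d
  D-split [] {R₂} {v} cs {cs′} d v∉cs v∉cs′ =
    trans (altSum-update cs _ _ v∉cs v∉cs′ λ c l v≢c →
             cong (λ t → e v c * D R₂ l d + t * shift (D R₂ l) d) (linear-≢ v≢c))
          (cong (λ t → D (unmarked v ∷ R₂) (cs ++ v ∷ cs′) d + t)
             (trans (cong (λ t → sgn cs * (e v v * x + t * y - (e v v * x + + 0 * y))) (linear-≡ v))
                    (simplify (sgn cs) (e v v) x y)))
    where
    x = D R₂ (cs ++ cs′) d
    y = shift (D R₂ (cs ++ cs′)) d
    simplify : ∀ s a x y → s * (a * x + + 1 * y - (a * x + + 0 * y)) ≡ + 1 * s * y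
    simplify = solve-∀
  D-split (r@(u , _) ∷ R₁) {R₂} {v} cs {cs′} d v∉cs v∉cs′ =
    -- If the top row takes column `v`, the mark below it has no effect; in any other column the
    -- induction hypothesis applies.
    trans (altSum-transfer cs _ _ _ (sgn R₁) v∉cs v∉cs′
             (cong₂ _+_ (cong (e u v *_) (D-unmark R₁ d v∉rest))
                        (cong (linear r v *_) (shift-D-unmark R₁ d v∉rest)))
             step)
          (cong (λ t → D ((r ∷ R₁) ++ unmarked v ∷ R₂) (cs ++ v ∷ cs′) d + - sgn R₁ * sgn cs * t)
                (pull-shift (cs ++ cs′) d))
    where
    v∉rest = Allₚ.++⁺ v∉cs v∉cs′
    k : V → List V → ℤ
    k c l = e u c * shift (D (R₁ ++ R₂) l) d + linear r c * shift (shift (D (R₁ ++ R₂) l)) d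
    pull-shift : ∀ l d → altSum (λ c l → e u c * shift (D (R₁ ++ R₂) l) d
                                         + linear r c * shift (shift (D (R₁ ++ R₂) l)) d) l ≡
                         shift (D (r ∷ R₁ ++ R₂) l) d
    pull-shift l zero    = altSum-zero l λ c _ → cong₂ _+_ (*-zeroʳ (e u c)) (*-zeroʳ (linear r c))
    pull-shift l (suc d) = refl
    shift-split : ∀ us {ws} d → All (v ≢_) us → All (v ≢_) ws →
      shift (D (R₁ ++ marked v ∷ R₂) (us ++ v ∷ ws)) d ≡
      shift (D (R₁ ++ unmarked v ∷ R₂) (us ++ v ∷ ws)) d
      + sgn R₁ * sgn us * shift (shift (D (R₁ ++ R₂) (us ++ ws))) d
    shift-split us zero    _    _    = sym (trans (+-identityˡ _) (*-zeroʳ (sgn R₁ * sgn us)))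
    shift-split us (suc d) v∉us v∉ws = D-split R₁ us d v∉us v∉ws
    regroup : ∀ a b x y s p q → a * (x + s * p) + b * (y + s * q) ≡ a * x + b * y + s * (a * p + b * q)
    regroup = solve-∀
    step : ∀ c us {ws} → v ≢ c → All (v ≢_) us → All (v ≢_) ws →
           e u c * D (R₁ ++ marked v ∷ R₂) (us ++ v ∷ ws) d
           + linear r c * shift (D (R₁ ++ marked v ∷ R₂) (us ++ v ∷ ws)) d ≡
           e u c * D (R₁ ++ unmarked v ∷ R₂) (us ++ v ∷ ws) d
           + linear r c * shift (D (R₁ ++ unmarked v ∷ R₂) (us ++ v ∷ ws)) d
           + sgn R₁ * sgn us * k c (us ++ ws)
    step c us {ws} v≢c v∉us v∉ws =
      trans (cong₂ _+_ (cong (e u c *_) (D-split R₁ us d v∉us v∉ws))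
                       (cong (linear r c *_) (shift-split us d v∉us v∉ws)))
            (regroup (e u c) (linear r c)
                     (D (R₁ ++ unmarked v ∷ R₂) (us ++ v ∷ ws) d)
                     (shift (D (R₁ ++ unmarked v ∷ R₂) (us ++ v ∷ ws)) d)
                     (sgn R₁ * sgn us)
                     (shift (D (R₁ ++ R₂) (us ++ ws)) d)
                     (shift (shift (D (R₁ ++ R₂) (us ++ ws))) d))

  detL : List V → List V → ℤ
  detL []      cs = + 1
  detL (u ∷ R) cs = altSum (λ c l → e u c * detL R l) cs

  D-unmarked-zero : ∀ R cs → D (map unmarked R) cs zero ≡ detL R cs
  D-unmarked-zero []      cs = refl
  D-unmarked-zero (u ∷ R) cs =
    altSum-cong cs λ c l → trans (+-identityʳ _) (cong (e u c *_) (D-unmarked-zero R l))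

  D-unmarked-suc : ∀ R cs d → D (map unmarked R) cs (suc d) ≡ + 0
  D-unmarked-suc []      cs d = refl
  D-unmarked-suc (u ∷ R) cs d =
    altSum-zero cs λ c l →
      cong₂ _+_ (trans (cong (e u c *_) (D-unmarked-suc R l d)) (*-zeroʳ (e u c)))
                (*-zeroˡ (D (map unmarked R) l d))

  -- The principal submatrix on `cs ++ rs`, with λ on the diagonal only at `rs`. It interpolates
  -- between a characteristic polynomial (`cs` empty) and a constant principal minor (`rs` empty).
  mixedDet : List V → List V → ℕ → ℤ
  mixedDet cs rs = D (map unmarked cs ++ map marked rs) (cs ++ rs)

  sgn-map² : ∀ cs → sgn (map unmarked cs) * sgn cs ≡ + 1
  sgn-map² []       = refl
  sgn-map² (c ∷ cs) = trans (neg² (sgn (map unmarked cs)) (sgn cs)) (sgn-map² cs)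
    where
    neg² : ∀ s t → - s * - t ≡ s * t
    neg² = solve-∀

  -- Either the constant part of row `v` is taken, or its λ, which deletes row and column `v`. Both
  -- stand at the same position, so the sign of the deletion is a square.
  mixedDet-step : ∀ cs v rs d → All (v ≢_) cs → All (v ≢_) rs →
           mixedDet cs (v ∷ rs) d ≡ mixedDet (cs ++ [ v ]) rs d + shift (mixedDet cs rs) d
  mixedDet-step cs v rs d v∉cs v∉rs =
    trans (D-split (map unmarked cs) cs d v∉cs v∉rs)
          (cong₂ _+_ (cong₂ (λ R l → D R l d) (sym rows) (sym (++-assoc cs [ v ] rs)))
                     (trans (cong (_* shift (mixedDet cs rs) d) (sgn-map² cs)) (*-identityˡ _)))
    where
    rows : map unmarked (cs ++ [ v ]) ++ map marked rs ≡
           map unmarked cs ++ unmarked v ∷ map marked rs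
    rows = trans (cong (_++ map marked rs) (map-++ unmarked cs [ v ]))
                 (++-assoc (map unmarked cs) _ _)

  minor : List V → ℤ
  minor cs = detL cs cs

  mixedDet-[] : ∀ cs d → mixedDet cs [] d ≡ D (map unmarked cs) cs d
  mixedDet-[] cs d = cong₂ (λ R l → D R l d) (++-identityʳ (map unmarked cs)) (++-identityʳ cs)

  Fresh : List V → List V → Set
  Fresh rs cs = All (λ v → All (v ≢_) cs) rs

  fresh-snoc : ∀ {rs cs v} → All (v ≢_) rs → Fresh rs cs → Fresh rs (cs ++ [ v ])
  fresh-snoc v∉rs f = All.zipWith (λ (v≢r , r∉cs) → Allₚ.++⁺ r∉cs ((v≢r ∘ sym) ∷ [])) (v∉rs , f)

  -- The degree in λ is at most the number of marked rows.
  mixedDet-high : ∀ cs rs d → Unique rs → Fresh rs cs → length rs ℕ.< d → mixedDet cs rs d ≡ + 0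
  mixedDet-high cs []       (suc d) _           _          _          =
    trans (mixedDet-[] cs (suc d)) (D-unmarked-suc cs cs d)
  mixedDet-high cs (v ∷ rs) (suc d) (v∉rs ∷ rs!) (v∉cs ∷ f) (ℕ.s≤s lt) =
    trans (mixedDet-step cs v rs (suc d) v∉cs v∉rs)
          (cong₂ _+_ (mixedDet-high (cs ++ [ v ]) rs (suc d) rs! (fresh-snoc v∉rs f) (ℕₚ.m<n⇒m<1+n lt))
                     (mixedDet-high cs rs d rs! f lt))

  -- Each vertex of `rs` is either moved into the minor or deleted at the price of one factor λ. For
  -- the coefficient of λ^d exactly `d` vertices are deleted, which leaves `t` for the minor.
  mixedDet-choose : ∀ t cs rs d → Unique rs → Fresh rs cs → d ℕ.+ t ≡ length rs →
             mixedDet cs rs d ≡ choose t (λ vs → minor (cs ++ Vec.toList vs)) rs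
  mixedDet-choose zero cs [] zero _ _ _ =
    trans (mixedDet-[] cs 0) (trans (D-unmarked-zero cs cs) (cong minor (sym (++-identityʳ cs))))
  mixedDet-choose zero cs (v ∷ rs) (suc d) (v∉rs ∷ rs!) (v∉cs ∷ f) eq =
    trans (mixedDet-step cs v rs (suc d) v∉cs v∉rs)
      -- With `t` zero every vertex must be deleted: keeping `v` would leave fewer than `suc d`
      -- marks.
      (trans (cong₂ _+_ (mixedDet-high (cs ++ [ v ]) rs (suc d) rs! (fresh-snoc v∉rs f) lt)
                        (mixedDet-choose zero cs rs d rs! f (ℕₚ.suc-injective eq)))
             (+-identityˡ _))
    where
    lt : length rs ℕ.< suc d
    lt = ℕₚ.≤-reflexive (cong suc (trans (sym (ℕₚ.suc-injective eq)) (ℕₚ.+-identityʳ d)))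
  mixedDet-choose (suc t) cs [] zero _ _ ()
  mixedDet-choose (suc t) cs [] (suc d) _ _ ()
  mixedDet-choose (suc t) cs (v ∷ rs) d (v∉rs ∷ rs!) (v∉cs ∷ f) eq =
    trans (mixedDet-step cs v rs d v∉cs v∉rs)
      (cong₂ _+_
        (trans (mixedDet-choose t (cs ++ [ v ]) rs d rs! (fresh-snoc v∉rs f) eq′)
               (choose-cong t rs λ vs → cong minor (++-assoc cs [ v ] (Vec.toList vs))))
        (removed d eq′))
    where
    eq′ : d ℕ.+ t ≡ length rs
    eq′ = ℕₚ.suc-injective (trans (sym (ℕₚ.+-suc d t)) eq)
    removed : ∀ d → d ℕ.+ t ≡ length rs →
              shift (mixedDet cs rs) d ≡ choose (suc t) (λ vs → minor (cs ++ Vec.toList vs)) rs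
    -- No deletion is allowed any more, and `rs` has only `t` vertices, too few to choose `suc t`.
    removed zero    eq = sym (choose-short (suc t) _ rs (ℕₚ.≤-reflexive (cong suc (sym eq))))
    removed (suc d) eq = mixedDet-choose (suc t) cs rs d rs! f (trans (ℕₚ.+-suc d t) eq)

-- Sums over tuples

full : (t : ℕ) → (Vec A t → ℤ) → List A → ℤ
full zero    g xs = g []
full (suc t) g xs = ∑ xs (λ x → full t (g ∘ (x ∷_)) xs)

full-cong : ∀ t {f g : Vec A t → ℤ} xs → (∀ v → f v ≡ g v) → full t f xs ≡ full t g xs
full-cong zero    xs h = h []
full-cong (suc t) xs h = ∑-cong xs λ x → full-cong t xs (h ∘ (x ∷_))

full-zero : ∀ t {g : Vec A t → ℤ} xs → (∀ v → g v ≡ + 0) → full t g xs ≡ + 0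
full-zero zero    xs h = h []
full-zero (suc t) xs h = ∑-zero xs λ x → full-zero t xs (h ∘ (x ∷_))

-- Only neighbouring arguments are compared: adjacent transpositions generate all permutations and
-- can bring any two equal arguments together.
HollowSymmetric : (t : ℕ) → (Vec A t → ℤ) → Set
HollowSymmetric (suc (suc t)) g =
  (∀ x v → g (x ∷ x ∷ v) ≡ + 0) ×
  (∀ x y v → g (x ∷ y ∷ v) ≡ g (y ∷ x ∷ v)) ×
  (∀ x → HollowSymmetric (suc t) (g ∘ (x ∷_)))
HollowSymmetric _ _ = ⊤

-- A tuple that contributes uses the head `x` at most once, since repetitions give zero. If it does
-- use `x`, symmetry moves it from any of the `suc t` positions to the front.
full-∷ : ∀ t {g : Vec A (suc t) → ℤ} x xs → HollowSymmetric (suc t) g →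
         full (suc t) g (x ∷ xs) ≡ + suc t * full t (g ∘ (x ∷_)) xs + full (suc t) g xs
full-∷ zero    {g} x xs _                         = cong (_+ full 1 g xs) (sym (*-identityˡ (g (x ∷ []))))
full-∷ (suc t) {g} x xs (hollow , symmetric , hs) = begin
  full (suc t) (g ∘ (x ∷_)) (x ∷ xs) + ∑ xs (λ y → full (suc t) (g ∘ (y ∷_)) (x ∷ xs))
    ≡⟨ cong₂ _+_ (full-∷ t x xs (hs x)) (∑-cong xs λ y → full-∷ t x xs (hs y)) ⟩
  + suc t * full t (g ∘ (x ∷_) ∘ (x ∷_)) xs + F
    + ∑ xs (λ y → + suc t * full t (g ∘ (y ∷_) ∘ (x ∷_)) xs + full (suc t) (g ∘ (y ∷_)) xs)
    ≡⟨ cong₂ _+_ (cong (λ z → + suc t * z + F) (full-zero t xs (hollow x)))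
                 (∑-+ xs (λ y → + suc t * full t (g ∘ (y ∷_) ∘ (x ∷_)) xs)
                         (λ y → full (suc t) (g ∘ (y ∷_)) xs)) ⟩
  + suc t * + 0 + F + (∑ xs (λ y → + suc t * full t (g ∘ (y ∷_) ∘ (x ∷_)) xs) + G)
    ≡⟨ cong (λ z → + suc t * + 0 + F + (z + G))
         (trans (∑-*ˡ xs (+ suc t) (λ y → full t (g ∘ (y ∷_) ∘ (x ∷_)) xs))
                (cong (+ suc t *_) (∑-cong xs λ y → full-cong t xs (symmetric y x)))) ⟩
  + suc t * + 0 + F + (+ suc t * F + G)
    ≡⟨ regroup (+ suc t) F G ⟩
  + suc (suc t) * F + G ∎
  where
  open ≡-Reasoning
  F = full (suc t) (g ∘ (x ∷_)) xs
  G = full (suc (suc t)) g xs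
  regroup : ∀ c f g → c * + 0 + f + (c * f + g) ≡ (+ 1 + c) * f + g
  regroup = solve-∀

full-choose : ∀ t {g : Vec A t → ℤ} xs → HollowSymmetric t g → full t g xs ≡ + (t !) * choose t g xs
full-choose zero    {g} xs       _  = sym (*-identityˡ (g []))
full-choose (suc t) {g} []       _  = sym (*-zeroʳ (+ (suc t !)))
full-choose (suc t) {g} (x ∷ xs) hs = begin
  full (suc t) g (x ∷ xs)
    ≡⟨ full-∷ t x xs hs ⟩
  + suc t * full t (g ∘ (x ∷_)) xs + full (suc t) g xs
    ≡⟨ cong₂ _+_ (cong (+ suc t *_) (full-choose t xs (tail t g hs))) (full-choose (suc t) xs hs) ⟩
  + suc t * (+ (t !) * choose t (g ∘ (x ∷_)) xs) + + (suc t !) * choose (suc t) g xs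
    ≡⟨ cong (_+ + (suc t !) * choose (suc t) g xs)
         (trans (sym (*-assoc (+ suc t) (+ (t !)) (choose t (g ∘ (x ∷_)) xs)))
                (cong (_* choose t (g ∘ (x ∷_)) xs) (sym (pos-* (suc t) (t !))))) ⟩
  + (suc t !) * choose t (g ∘ (x ∷_)) xs + + (suc t !) * choose (suc t) g xs
    ≡⟨ sym (*-distribˡ-+ (+ (suc t !)) (choose t (g ∘ (x ∷_)) xs) (choose (suc t) g xs)) ⟩
  + (suc t !) * choose (suc t) g (x ∷ xs) ∎
  where
  open ≡-Reasoning
  tail : ∀ t (g : Vec _ (suc t) → ℤ) → HollowSymmetric (suc t) g → HollowSymmetric t (g ∘ (x ∷_))
  tail zero    g _            = tt
  tail (suc t) g (_ , _ , hs) = hs x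

-- Hollow symmetric 4 × 4 determinants

uncurry₄ : (A → A → A → A → ℤ) → Vec A 4 → ℤ
uncurry₄ f (a ∷ b ∷ c ∷ d ∷ []) = f a b c d

-- The determinant of a hollow symmetric 4 × 4 matrix depends only on the products
-- x, y, z of its entries over the three perfect matchings of the index set.
matchingForm : ℤ → ℤ → ℤ → ℤ
matchingForm x y z = x * x + y * y + z * z - (x * y + x * z + y * z) - (x * y + x * z + y * z)

minorForm : (A → A → ℤ) → A → A → A → A → ℤ
minorForm e a b c d = matchingForm (e a b * e c d) (e a c * e b d) (e a d * e b c)

module _ {N : ℕ} (e : Fin N → Fin N → ℤ)
         (e-hollow : ∀ u → e u u ≡ + 0) (e-sym : ∀ u v → e u v ≡ e v u) where

  open Minors e

  detL₂ : ∀ u₁ u₂ c₁ c₂ → detL (u₁ ∷ u₂ ∷ []) (c₁ ∷ c₂ ∷ []) ≡ e u₁ c₁ * e u₂ c₂ - e u₁ c₂ * e u₂ c₁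
  detL₂ u₁ u₂ c₁ c₂ = expand (e u₁ c₁) (e u₁ c₂) (e u₂ c₁) (e u₂ c₂)
    where
    expand : ∀ p q r s → p * (s * + 1 - + 0) - (q * (r * + 1 - + 0) - + 0) ≡ p * s - q * r
    expand = solve-∀

  -- The trailing `- + 0` is what `altSum` leaves at the end of the column list; it is kept so that
  -- the forms fit together without normalisation.
  detL₃ : ∀ u₁ u₂ u₃ c₁ c₂ c₃ → detL (u₁ ∷ u₂ ∷ u₃ ∷ []) (c₁ ∷ c₂ ∷ c₃ ∷ []) ≡
          e u₁ c₁ * (e u₂ c₂ * e u₃ c₃ - e u₂ c₃ * e u₃ c₂)
          - (e u₁ c₂ * (e u₂ c₁ * e u₃ c₃ - e u₂ c₃ * e u₃ c₁)
          - (e u₁ c₃ * (e u₂ c₁ * e u₃ c₂ - e u₂ c₂ * e u₃ c₁) - + 0))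
  detL₃ u₁ u₂ u₃ c₁ c₂ c₃ =
    cong₂ _-_ (cong (e u₁ c₁ *_) (detL₂ u₂ u₃ c₂ c₃))
      (cong₂ _-_ (cong (e u₁ c₂ *_) (detL₂ u₂ u₃ c₁ c₃))
        (cong (λ t → e u₁ c₃ * t - + 0) (detL₂ u₂ u₃ c₁ c₂)))

  -- Diagonal entries are replaced by zero and lower entries by upper ones before the ring solver is
  -- called, which leaves an identity in the six upper entries. The cofactor `m` of the zero entry
  -- `e a a` stays unexpanded.
  minor₄ : ∀ a b c d → minor (a ∷ b ∷ c ∷ d ∷ []) ≡ minorForm e a b c d
  minor₄ a b c d =
    trans (cong₂ _-_ (cong (_* detL (b ∷ c ∷ d ∷ []) (b ∷ c ∷ d ∷ [])) (e-hollow a))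
            (cong₂ _-_ (cong (e a b *_) (detL₃ b c d a c d))
              (cong₂ _-_ (cong (e a c *_) (detL₃ b c d a b d))
                (cong (λ t → e a d * t - + 0) (detL₃ b c d a b c)))))
          (expand (detL (b ∷ c ∷ d ∷ []) (b ∷ c ∷ d ∷ []))
             (e-hollow b) (e-hollow c) (e-hollow d)
             (e-sym b a) (e-sym c a) (e-sym d a) (e-sym c b) (e-sym d b) (e-sym d c))
    where
    polynomial : ∀ m p q r s t u →
      + 0 * m
      - (p * (p * (+ 0 * + 0 - u * u) - (s * (q * + 0 - u * r) - (t * (q * u - + 0 * r) - + 0)))
      - (q * (p * (s * + 0 - u * t) - (+ 0 * (q * + 0 - u * r) - (t * (q * t - s * r) - + 0)))
      - (r * (p * (s * u - + 0 * t) - (+ 0 * (q * u - + 0 * r) - (s * (q * t - s * r) - + 0))) - + 0)))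
      ≡ (p * u) * (p * u) + (q * t) * (q * t) + (r * s) * (r * s)
        - ((p * u) * (q * t) + (p * u) * (r * s) + (q * t) * (r * s))
        - ((p * u) * (q * t) + (p * u) * (r * s) + (q * t) * (r * s))
    polynomial = solve-∀
    expand : ∀ m {ab ac ad ba bb bc bd ca cb cc cd da db dc dd} →
      bb ≡ + 0 → cc ≡ + 0 → dd ≡ + 0 →
      ba ≡ ab → ca ≡ ac → da ≡ ad → cb ≡ bc → db ≡ bd → dc ≡ cd →
      + 0 * m
      - (ab * (ba * (cc * dd - cd * dc) - (bc * (ca * dd - cd * da) - (bd * (ca * dc - cc * da) - + 0)))
      - (ac * (ba * (cb * dd - cd * db) - (bb * (ca * dd - cd * da) - (bd * (ca * db - cb * da) - + 0)))
      - (ad * (ba * (cb * dc - cc * db) - (bb * (ca * dc - cc * da) - (bc * (ca * db - cb * da) - + 0))) - + 0)))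
      ≡ matchingForm (ab * cd) (ac * bd) (ad * bc)
    expand m {p} {q} {r} {_} {_} {s} {t} {_} {_} {_} {u} refl refl refl refl refl refl refl refl refl =
      polynomial m p q r s t u

  -- A permutation of the vertices permutes the three matchings, and `matchingForm` is symmetric. If
  -- two vertices coincide, one matching contains a loop and the other two have equal products, and
  -- `matchingForm` vanishes at (0, y, y).
  minorForm-hollowSymmetric : HollowSymmetric 4 (uncurry₄ (minorForm e))
  minorForm-hollowSymmetric =
    (λ { a (c ∷ d ∷ []) → trans (cong (λ t → matchingForm (t * e c d) (e a c * e a d) (e a d * e a c)) (e-hollow a))
                                (dup₁ (e c d) (e a c) (e a d)) }) ,
    (λ { a b (c ∷ d ∷ []) → trans (cong (λ t → matchingForm (t * e c d) (e a c * e b d) (e a d * e b c)) (e-sym a b))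
                                  (swap₁ (e b a) (e c d) (e a c) (e b d) (e a d) (e b c)) }) ,
    λ a →
      (λ { b (d ∷ []) → trans (cong (λ t → matchingForm (e a b * e b d) (e a b * e b d) (e a d * t)) (e-hollow b))
                              (dup₂ (e a b) (e b d) (e a d)) }) ,
      (λ { b c (d ∷ []) → trans (cong (λ t → matchingForm (e a b * e c d) (e a c * e b d) (e a d * t)) (e-sym b c))
                                (swap₂ (e a b * e c d) (e a c * e b d) (e a d * e c b)) }) ,
      λ b →
        (λ { c [] → trans (cong (λ t → matchingForm (e a b * t) (e a c * e b c) (e a c * e b c)) (e-hollow c))
                          (dup₃ (e a b) (e a c) (e b c)) }) ,
        (λ { c d [] → trans (cong (λ t → matchingForm (e a b * t) (e a c * e b d) (e a d * e b c)) (e-sym c d))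
                            (swap₃ (e a b * e d c) (e a c * e b d) (e a d * e b c)) }) ,
        λ _ → tt
    where
    dup₁ : ∀ p q r → + 0 * p * (+ 0 * p) + q * r * (q * r) + r * q * (r * q)
                     - (+ 0 * p * (q * r) + + 0 * p * (r * q) + q * r * (r * q))
                     - (+ 0 * p * (q * r) + + 0 * p * (r * q) + q * r * (r * q)) ≡ + 0
    dup₁ = solve-∀
    dup₂ : ∀ p q r → p * q * (p * q) + p * q * (p * q) + r * + 0 * (r * + 0)
                     - (p * q * (p * q) + p * q * (r * + 0) + p * q * (r * + 0))
                     - (p * q * (p * q) + p * q * (r * + 0) + p * q * (r * + 0)) ≡ + 0
    dup₂ = solve-∀
    dup₃ : ∀ p q r → p * + 0 * (p * + 0) + q * r * (q * r) + q * r * (q * r)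
                     - (p * + 0 * (q * r) + p * + 0 * (q * r) + q * r * (q * r))
                     - (p * + 0 * (q * r) + p * + 0 * (q * r) + q * r * (q * r)) ≡ + 0
    dup₃ = solve-∀
    swap₁ : ∀ p q r s t u →
      p * q * (p * q) + r * s * (r * s) + t * u * (t * u)
      - (p * q * (r * s) + p * q * (t * u) + r * s * (t * u))
      - (p * q * (r * s) + p * q * (t * u) + r * s * (t * u)) ≡
      p * q * (p * q) + u * t * (u * t) + s * r * (s * r)
      - (p * q * (u * t) + p * q * (s * r) + u * t * (s * r))
      - (p * q * (u * t) + p * q * (s * r) + u * t * (s * r))
    swap₁ = solve-∀
    swap₂ : ∀ x y z → x * x + y * y + z * z - (x * y + x * z + y * z) - (x * y + x * z + y * z) ≡
                      y * y + x * x + z * z - (y * x + y * z + x * z) - (y * x + y * z + x * z)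
    swap₂ = solve-∀
    swap₃ : ∀ x y z → x * x + y * y + z * z - (x * y + x * z + y * z) - (x * y + x * z + y * z) ≡
                      x * x + z * z + y * y - (x * z + x * y + z * y) - (x * z + x * y + z * y)
    swap₃ = solve-∀

-- From 4-tuples to traces

full-+ : ∀ t (f g : Vec A t → ℤ) xs → full t (λ v → f v + g v) xs ≡ full t f xs + full t g xs
full-+ zero    f g xs = refl
full-+ (suc t) f g xs =
  trans (∑-cong xs λ x → full-+ t (f ∘ (x ∷_)) (g ∘ (x ∷_)) xs)
        (∑-+ xs (λ x → full t (f ∘ (x ∷_)) xs) (λ x → full t (g ∘ (x ∷_)) xs))

full-*ˡ : ∀ t c (f : Vec A t → ℤ) xs → full t (λ v → c * f v) xs ≡ c * full t f xs
full-*ˡ zero    c f xs = refl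
full-*ˡ (suc t) c f xs =
  trans (∑-cong xs λ x → full-*ˡ t c (f ∘ (x ∷_)) xs) (∑-*ˡ xs c (λ x → full t (f ∘ (x ∷_)) xs))

∑-square : ∀ (xs : List A) (f : A → ℤ) → ∑ xs (λ x → ∑ xs λ y → f x * f y) ≡ ∑ xs f * ∑ xs f
∑-square xs f = trans (∑-cong xs λ x → ∑-*ˡ xs (f x) f) (∑-*ʳ xs f (∑ xs f))

closedWalk : (A → A → ℤ) → A → A → A → A → ℤ
closedWalk e a b c d = e a b * e b c * (e c d * e d a)

module _ (xs : List A) where

  ∑⁴ : (A → A → A → A → ℤ) → ℤ
  ∑⁴ f = full 4 (uncurry₄ f) xs

  ∑⁴-cong : ∀ {f g} → (∀ a b c d → f a b c d ≡ g a b c d) → ∑⁴ f ≡ ∑⁴ g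
  ∑⁴-cong h = ∑-cong xs λ a → ∑-cong xs λ b → ∑-cong xs λ c → ∑-cong xs λ d → h a b c d

  ∑⁴-swap₁ : ∀ f → ∑⁴ f ≡ ∑⁴ (λ a b c d → f b a c d)
  ∑⁴-swap₁ f = ∑-swap xs xs (λ a b → ∑ xs λ c → ∑ xs λ d → f a b c d)

  ∑⁴-swap₂ : ∀ f → ∑⁴ f ≡ ∑⁴ (λ a b c d → f a c b d)
  ∑⁴-swap₂ f = ∑-cong xs λ a → ∑-swap xs xs (λ b c → ∑ xs λ d → f a b c d)

  ∑⁴-swap₃ : ∀ f → ∑⁴ f ≡ ∑⁴ (λ a b c d → f a b d c)
  ∑⁴-swap₃ f = ∑-cong xs λ a → ∑-cong xs λ b → ∑-swap xs xs (λ c d → f a b c d)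

  ∑⁴-product : ∀ (f : A → A → ℤ) →
               ∑⁴ (λ a b c d → f a b * f c d) ≡ ∑ xs (λ a → ∑ xs (f a)) * ∑ xs (λ a → ∑ xs (f a))
  ∑⁴-product f =
    trans (∑-cong xs λ a → trans (∑-cong xs λ b →
              trans (∑-cong xs λ c → ∑-*ˡ xs (f a b) (f c)) (∑-*ˡ xs (f a b) (λ c → ∑ xs (f c))))
            (∑-*ʳ xs (f a) total))
          (∑-*ʳ xs (λ a → ∑ xs (f a)) total)
    where
    total = ∑ xs (λ c → ∑ xs (f c))

  module _ (e : A → A → ℤ) (e-sym : ∀ u v → e u v ≡ e v u) where

    -- Two copies of one matching are two independent doubled edges, which gives the 3 products
    -- `S * S`. Two different matchings together form a 4-cycle; there are three such pairs, each
    -- with coefficient -2, which gives the 6.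
    ∑⁴-minorForm :
      ∑⁴ (minorForm e) ≡
      + 3 * (∑ xs (λ a → ∑ xs (λ b → e a b * e a b)) * ∑ xs (λ a → ∑ xs (λ b → e a b * e a b)))
      - + 6 * ∑⁴ (closedWalk e)
    ∑⁴-minorForm = begin
      ∑⁴ (λ a b c d → matchingForm (x a b c d) (y a b c d) (z a b c d))
        ≡⟨ ∑⁴-cong (λ a b c d → expand (x a b c d) (y a b c d) (z a b c d)) ⟩
      ∑⁴ (λ a b c d → squares a b c d + - + 2 * mixed a b c d)
        ≡⟨ trans (full-+ 4 (uncurry₄ squares) (λ v → - + 2 * uncurry₄ mixed v) xs)
                 (cong (_+_ (∑⁴ squares)) (full-*ˡ 4 (- + 2) (uncurry₄ mixed) xs)) ⟩
      ∑⁴ squares + - + 2 * ∑⁴ mixed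
        ≡⟨ cong₂ (λ s t → s + - + 2 * t)
             (∑⁴-+³ (λ a b c d → x a b c d * x a b c d) (λ a b c d → y a b c d * y a b c d)
                    (λ a b c d → z a b c d * z a b c d))
             (∑⁴-+³ (λ a b c d → x a b c d * y a b c d) (λ a b c d → x a b c d * z a b c d)
                    (λ a b c d → y a b c d * z a b c d)) ⟩
      ∑⁴ (λ a b c d → x a b c d * x a b c d) + ∑⁴ (λ a b c d → y a b c d * y a b c d)
        + ∑⁴ (λ a b c d → z a b c d * z a b c d)
        + - + 2 * (∑⁴ (λ a b c d → x a b c d * y a b c d) + ∑⁴ (λ a b c d → x a b c d * z a b c d)
                   + ∑⁴ (λ a b c d → y a b c d * z a b c d))
        ≡⟨ cong₂ (λ s t → s + - + 2 * t) (cong₂ _+_ (cong₂ _+_ xx yy) zz) (cong₂ _+_ (cong₂ _+_ xy xz) yz) ⟩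
      S * S + S * S + S * S + - + 2 * (Q + Q + Q)
        ≡⟨ collect (S * S) Q ⟩
      + 3 * (S * S) - + 6 * Q ∎
      where
      open ≡-Reasoning
      x y z squares mixed : A → A → A → A → ℤ
      x a b c d = e a b * e c d
      y a b c d = e a c * e b d
      z a b c d = e a d * e b c
      squares a b c d = x a b c d * x a b c d + y a b c d * y a b c d + z a b c d * z a b c d
      mixed   a b c d = x a b c d * y a b c d + x a b c d * z a b c d + y a b c d * z a b c d
      S = ∑ xs (λ a → ∑ xs (λ b → e a b * e a b))
      Q = ∑⁴ (closedWalk e)
      ∑⁴-+³ : ∀ f g h → ∑⁴ (λ a b c d → f a b c d + g a b c d + h a b c d) ≡ ∑⁴ f + ∑⁴ g + ∑⁴ h
      ∑⁴-+³ f g h =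
        trans (full-+ 4 (λ v → uncurry₄ f v + uncurry₄ g v) (uncurry₄ h) xs)
              (cong (_+ ∑⁴ h) (full-+ 4 (uncurry₄ f) (uncurry₄ g) xs))
      expand : ∀ x y z → x * x + y * y + z * z - (x * y + x * z + y * z) - (x * y + x * z + y * z) ≡
               x * x + y * y + z * z + - + 2 * (x * y + x * z + y * z)
      expand = solve-∀
      collect : ∀ t q → t + t + t + - + 2 * (q + q + q) ≡ + 3 * t - + 6 * q
      collect = solve-∀
      square : ∀ p q → p * q * (p * q) ≡ p * p * (q * q)
      square = solve-∀
      xx : ∑⁴ (λ a b c d → x a b c d * x a b c d) ≡ S * S
      xx = trans (∑⁴-cong λ a b c d → square (e a b) (e c d)) (∑⁴-product λ a b → e a b * e a b)
      yy : ∑⁴ (λ a b c d → y a b c d * y a b c d) ≡ S * S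
      yy = trans (∑⁴-swap₂ λ a b c d → y a b c d * y a b c d) xx
      zz : ∑⁴ (λ a b c d → z a b c d * z a b c d) ≡ S * S
      zz = trans (∑⁴-swap₃ λ a b c d → z a b c d * z a b c d) yy
      walk : ∀ ab bc cd ad {da} → da ≡ ad → ab * cd * (ad * bc) ≡ ab * bc * (cd * da)
      walk ab bc cd ad refl = reorder ab bc cd ad
        where
        reorder : ∀ ab bc cd ad → ab * cd * (ad * bc) ≡ ab * bc * (cd * ad)
        reorder = solve-∀
      xz : ∑⁴ (λ a b c d → x a b c d * z a b c d) ≡ Q
      xz = ∑⁴-cong λ a b c d → walk (e a b) (e b c) (e c d) (e a d) (e-sym d a)
      xy : ∑⁴ (λ a b c d → x a b c d * y a b c d) ≡ Q
      xy = trans (∑⁴-swap₃ λ a b c d → x a b c d * y a b c d)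
                 (trans (∑⁴-cong λ a b c d → cong (λ t → e a b * t * (e a d * e b c)) (e-sym d c)) xz)
      yz : ∑⁴ (λ a b c d → y a b c d * z a b c d) ≡ Q
      yz = trans (∑⁴-swap₂ λ a b c d → y a b c d * z a b c d)
                 (trans (∑⁴-cong λ a b c d → cong (λ t → e a b * e c d * (e a d * t)) (e-sym c b)) xz)

-- Bipartite graphs

-- χ and ψ are the indicators of the two colour classes of a bipartite graph with 0/1 adjacency a.
module Bipartite (xs : List A) (a : A → A → ℤ) (a-sym : ∀ u v → a u v ≡ a v u)
                 (χ ψ : A → ℤ) (χ+ψ : ∀ u → χ u + ψ u ≡ + 1) (χ² : ∀ u → χ u * χ u ≡ χ u)
                 (ψχ : ∀ u v → ψ u * a u v ≡ χ v * a u v)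
                 where

  degree : A → ℤ
  degree u = ∑ xs (a u)

  common : A → A → ℤ
  common u w = ∑ xs (λ v → a u v * a w v)

  private
    split : ∀ (f : A → ℤ) → ∑ xs f ≡ ∑ xs (λ u → χ u * f u) + ∑ xs (λ u → ψ u * f u)
    split f = trans (∑-cong xs λ u →
                       trans (sym (*-identityˡ (f u)))
                         (trans (cong (_* f u) (sym (χ+ψ u))) (*-distribʳ-+ (f u) (χ u) (ψ u))))
                    (∑-+ xs (λ u → χ u * f u) (λ u → ψ u * f u))

    double : ∀ s → s + s ≡ + 2 * s
    double = solve-∀

  -- Every edge has one end in each class, so both classes have the same degree sum.
  ∑-degree : ∑ xs degree ≡ + 2 * ∑ xs (λ u → χ u * degree u)
  ∑-degree = begin
    ∑ xs degree
      ≡⟨ split degree ⟩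
    S + ∑ xs (λ u → ψ u * degree u)
      ≡⟨ cong (_+_ S) (∑-cong xs λ u → sym (∑-*ˡ xs (ψ u) (a u))) ⟩
    S + ∑ xs (λ u → ∑ xs λ v → ψ u * a u v)
      ≡⟨ cong (_+_ S) (∑-cong xs λ u → ∑-cong xs λ v →
           trans (ψχ u v) (cong (χ v *_) (a-sym u v))) ⟩
    S + ∑ xs (λ u → ∑ xs λ v → χ v * a v u)
      ≡⟨ cong (_+_ S) (∑-swap xs xs λ u v → χ v * a v u) ⟩
    S + ∑ xs (λ v → ∑ xs λ u → χ v * a v u)
      ≡⟨ cong (_+_ S) (∑-cong xs λ v → ∑-*ˡ xs (χ v) (a v)) ⟩
    S + S
      ≡⟨ double S ⟩
    + 2 * S ∎
    where
    open ≡-Reasoning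
    S = ∑ xs (λ u → χ u * degree u)

  private
    walk : A → A → A → A → ℤ
    walk = closedWalk a

    -- Two neighbours of `v` lie in the same class, namely the one opposite to `v`; the proof passes
    -- through `ψ v`.
    colour : ∀ u v w → χ u * (a u v * a w v) ≡ χ w * (a u v * a w v)
    colour u v w = begin
      χ u * (a u v * a w v)       ≡⟨ sym (*-assoc (χ u) (a u v) (a w v)) ⟩
      χ u * a u v * a w v         ≡⟨ cong (λ t → χ u * t * a w v) (a-sym u v) ⟩
      χ u * a v u * a w v         ≡⟨ cong (_* a w v) (sym (ψχ v u)) ⟩
      ψ v * a v u * a w v         ≡⟨ cong (λ t → ψ v * a v u * t) (a-sym w v) ⟩
      ψ v * a v u * a v w         ≡⟨ exchange (ψ v) (a v u) (a v w) ⟩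
      ψ v * a v w * a v u         ≡⟨ cong (_* a v u) (ψχ v w) ⟩
      χ w * a v w * a v u         ≡⟨ cong₂ (λ s t → χ w * s * t) (a-sym v w) (a-sym v u) ⟩
      χ w * a w v * a u v         ≡⟨ exchange′ (χ w) (a w v) (a u v) ⟩
      χ w * (a u v * a w v)       ∎
      where
      open ≡-Reasoning
      exchange : ∀ p q r → p * q * r ≡ p * r * q
      exchange = solve-∀
      exchange′ : ∀ p q r → p * q * r ≡ p * (r * q)
      exchange′ = solve-∀

    colour-common : ∀ u w → χ u * common u w ≡ χ w * common u w
    colour-common u w =
      trans (sym (∑-*ˡ xs (χ u) (λ v → a u v * a w v)))
        (trans (∑-cong xs λ v → colour u v w) (∑-*ˡ xs (χ w) (λ v → a u v * a w v)))

    walk-common : ∀ u w → ∑ xs (λ v → ∑ xs λ z → walk u v w z) ≡ common u w * common u w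
    walk-common u w =
      trans (∑-cong xs λ v → ∑-cong xs λ z →
               cong₂ (λ s t → a u v * s * t) (a-sym v w)
                     (trans (*-comm (a w z) (a z u)) (cong (_* a w z) (a-sym z u))))
            (∑-square xs (λ v → a u v * a w v))

    coloured-walks : ∀ u → χ u * ∑ xs (λ v → ∑ xs λ w → ∑ xs λ z → walk u v w z) ≡
                     χ u * ∑ xs (λ w → χ w * (common u w * common u w))
    coloured-walks u = begin
      χ u * ∑ xs (λ v → ∑ xs λ w → ∑ xs λ z → walk u v w z)
        ≡⟨ cong (χ u *_) (trans (∑-swap xs xs λ v w → ∑ xs λ z → walk u v w z)
                                (∑-cong xs (walk-common u))) ⟩
      χ u * ∑ xs (λ w → common u w * common u w)
        ≡⟨ sym (∑-*ˡ xs (χ u) λ w → common u w * common u w) ⟩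
      ∑ xs (λ w → χ u * (common u w * common u w))
        ≡⟨ ∑-cong xs (λ w → move w) ⟩
      ∑ xs (λ w → χ u * (χ w * (common u w * common u w)))
        ≡⟨ ∑-*ˡ xs (χ u) (λ w → χ w * (common u w * common u w)) ⟩
      χ u * ∑ xs (λ w → χ w * (common u w * common u w)) ∎
      where
      open ≡-Reasoning
      regroup : ∀ p q d → p * (q * d * d) ≡ p * (q * (d * d))
      regroup = solve-∀
      regroup′ : ∀ p d → p * p * (d * d) ≡ p * (p * d * d)
      regroup′ = solve-∀
      move : ∀ w → χ u * (common u w * common u w) ≡ χ u * (χ w * (common u w * common u w))
      move w =
        -- Idempotence supplies a second copy of `χ u`; this copy is the one turned into `χ w`.
        trans (cong (_* (common u w * common u w)) (sym (χ² u)))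
          (trans (regroup′ (χ u) (common u w))
            (trans (cong (λ t → χ u * (t * common u w)) (colour-common u w))
                   (regroup (χ u) (χ w) (common u w))))

  -- Starting a closed walk one step later moves its start to the other class, so both classes
  -- contribute equally. A walk from `u` with middle vertex `w` consists of two independent choices
  -- of a common neighbour.
  ∑⁴-walk : ∑⁴ xs walk ≡ + 2 * ∑ xs (λ u → χ u * ∑ xs (λ w → χ w * (common u w * common u w)))
  ∑⁴-walk = begin
    ∑⁴ xs walk
      ≡⟨ split from ⟩
    ∑ xs (λ u → χ u * from u) + ∑ xs (λ u → ψ u * from u)
      ≡⟨ cong (_+_ S) other-side ⟩
    S + S
      ≡⟨ double S ⟩
    + 2 * S
      ≡⟨ cong (+ 2 *_) (∑-cong xs coloured-walks) ⟩
    + 2 * ∑ xs (λ u → χ u * ∑ xs (λ w → χ w * (common u w * common u w))) ∎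
    where
    open ≡-Reasoning
    from : A → ℤ
    from u = ∑ xs λ v → ∑ xs λ w → ∑ xs λ z → walk u v w z
    S = ∑ xs (λ u → χ u * from u)
    weigh : ∀ (c : A → ℤ) → ∑ xs (λ u → c u * from u) ≡ ∑⁴ xs (λ u v w z → c u * walk u v w z)
    weigh c = ∑-cong xs λ u →
      trans (sym (∑-*ˡ xs (c u) λ v → ∑ xs λ w → ∑ xs λ z → walk u v w z)) (∑-cong xs λ v →
        trans (sym (∑-*ˡ xs (c u) λ w → ∑ xs λ z → walk u v w z)) (∑-cong xs λ w →
          sym (∑-*ˡ xs (c u) λ z → walk u v w z)))
    recolour : ∀ u v w z → ψ u * walk u v w z ≡ χ v * walk v w z u
    recolour u v w z =
      trans (pull (ψ u) (a u v) (a v w) (a w z) (a z u))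
        (trans (cong (_* (a v w * (a w z * a z u))) (ψχ u v))
               (push (χ v) (a u v) (a v w) (a w z) (a z u)))
      where
      pull : ∀ c p q r s → c * (p * q * (r * s)) ≡ c * p * (q * (r * s))
      pull = solve-∀
      push : ∀ c p q r s → c * p * (q * (r * s)) ≡ c * (q * r * (s * p))
      push = solve-∀
    other-side : ∑ xs (λ u → ψ u * from u) ≡ S
    other-side =
      trans (weigh ψ) (trans (∑⁴-cong xs recolour)
        -- Three adjacent swaps compose to the cyclic rotation of the four vertices.
        (trans (∑⁴-swap₁ xs λ u v w z → χ v * walk v w z u)
          (trans (∑⁴-swap₂ xs λ u v w z → χ u * walk u w z v)
            (trans (∑⁴-swap₃ xs λ u v w z → χ u * walk u v z w)
                   (sym (weigh χ))))))

-- Pairs of nested rows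

pairSum : (A → ℤ) → List A → ℤ
pairSum r []       = + 0
pairSum r (x ∷ xs) = ∑ xs (λ y → r x * r y - r y * r y) + pairSum r xs

-- The diagonal terms cancel because `g x x` is `r x`. An unordered pair with `y` after `x` occurs
-- twice on the left, each time as `r x * r y - r y * r y`.
nested-rows : ∀ {xs : List A} (r : A → ℤ) (g : A → A → ℤ) → (∀ x → g x x ≡ r x) →
              (∀ x y → g x y ≡ g y x) → AllPairs (λ x y → g x y ≡ r y) xs →
              ∑ xs r * ∑ xs r - ∑ xs (λ x → ∑ xs λ y → g x y * g x y) ≡ + 2 * pairSum r xs
nested-rows r g g-diag g-sym [] = refl
nested-rows {xs = x ∷ xs} r g g-diag g-sym (later ∷ rest) = begin
  (r x + R) * (r x + R) - ((g x x * g x x + G) + ∑ xs (λ y → g y x * g y x + ∑ xs λ z → g y z * g y z))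
    ≡⟨ cong (λ t → (r x + R) * (r x + R) - t)
         (cong₂ _+_ (cong₂ _+_ (cong₂ _*_ (g-diag x) (g-diag x)) G≡)
           (trans (∑-+ xs (λ y → g y x * g y x) (λ y → ∑ xs λ z → g y z * g y z))
                  (cong (_+ M) (trans (∑-cong xs λ y → cong₂ _*_ (g-sym y x) (g-sym y x)) G≡)))) ⟩
  (r x + R) * (r x + R) - ((r x * r x + K) + (K + M))
    ≡⟨ regroup (r x) R K M ⟩
  (R * R - M) + + 2 * (r x * R + - + 1 * K)
    ≡⟨ cong₂ (λ s t → s + + 2 * t) (nested-rows r g g-diag g-sym rest) (sym first-row) ⟩
  + 2 * pairSum r xs + + 2 * ∑ xs (λ y → r x * r y - r y * r y)
    ≡⟨ factor (pairSum r xs) (∑ xs (λ y → r x * r y - r y * r y)) ⟩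
  + 2 * pairSum r (x ∷ xs) ∎
  where
  open ≡-Reasoning
  R = ∑ xs r
  G = ∑ xs (λ y → g x y * g x y)
  K = ∑ xs (λ y → r y * r y)
  M = ∑ xs (λ y → ∑ xs λ z → g y z * g y z)
  square-later : ∀ {ys} → All (λ y → g x y ≡ r y) ys →
                 ∑ ys (λ y → g x y * g x y) ≡ ∑ ys (λ y → r y * r y)
  square-later []       = refl
  square-later (p ∷ ps) = cong₂ _+_ (cong₂ _*_ p p) (square-later ps)
  G≡ : G ≡ K
  G≡ = square-later later
  first-row : ∑ xs (λ y → r x * r y - r y * r y) ≡ r x * R + - + 1 * K
  first-row =
    trans (∑-cong xs λ y → minus (r x * r y) (r y * r y))
      (trans (∑-+ xs (λ y → r x * r y) (λ y → - + 1 * (r y * r y)))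
             (cong₂ _+_ (∑-*ˡ xs (r x) r) (∑-*ˡ xs (- + 1) (λ y → r y * r y))))
    where
    minus : ∀ p q → p - q ≡ p + - + 1 * q
    minus = solve-∀
  regroup : ∀ p R K M → (p + R) * (p + R) - ((p * p + K) + (K + M)) ≡
            (R * R - M) + + 2 * (p * R + - + 1 * K)
  regroup = solve-∀
  factor : ∀ p q → + 2 * p + + 2 * q ≡ + 2 * (q + p)
  factor = solve-∀

-- The Young sum

∑< : ℕ → (ℕ → ℤ) → ℤ
∑< zero    f = + 0
∑< (suc n) f = f 0 + ∑< n (f ∘ suc)

∑<-cong : ∀ n {f g : ℕ → ℤ} → (∀ t → f t ≡ g t) → ∑< n f ≡ ∑< n g
∑<-cong zero    h = refl
∑<-cong (suc n) h = cong₂ _+_ (h 0) (∑<-cong n (h ∘ suc))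

∑<-*ˡ : ∀ n c (f : ℕ → ℤ) → ∑< n (λ t → c * f t) ≡ c * ∑< n f
∑<-*ˡ zero    c f = sym (*-zeroʳ c)
∑<-*ˡ (suc n) c f = trans (cong (_+_ (c * f 0)) (∑<-*ˡ n c (f ∘ suc))) (sym (*-distribˡ-+ c (f 0) (∑< n (f ∘ suc))))

foldr-applyUpTo : ∀ n (f : A → ℤ) (g : ℕ → A) → foldr _+_ (+ 0) (map f (applyUpTo g n)) ≡ ∑< n (f ∘ g)
foldr-applyUpTo zero    f g = refl
foldr-applyUpTo (suc n) f g = cong (_+_ (f (g 0))) (foldr-applyUpTo n f (g ∘ suc))

sumFromTo-∑< : ∀ a b f → sumFromTo a b f ≡ ∑< (suc b ∸ a) (λ t → f (a ℕ.+ t))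
sumFromTo-∑< a b f = foldr-applyUpTo (suc b ∸ a) (λ t → f (a ℕ.+ t)) id

∑<-at : ∀ r → ∑< (length r) (λ t → + at r (suc t)) ≡ ∑ r pos
∑<-at []      = refl
∑<-at (x ∷ r) = cong (_+_ (+ x)) (∑<-at r)

-- The factor i is replaced by c + i, so that the induction on the list of rows can shift it.
shiftedYoungSum : ℕ → List ℕ → ℤ
shiftedYoungSum c r =
  ∑< (length r ∸ 1) λ t → ∑< (length r ∸ suc t) λ s →
    (+ at r (suc t) - + at r (suc (suc t))) * + (c ℕ.+ suc t) * + at r (suc (suc t ℕ.+ s))

-- The share of the first row `x` in `pairSum pos (x ∷ ys)`.
excess : ℕ → List ℕ → ℤ
excess x ys = ∑ ys (λ y → + x * + y - + y * + y)

excess-shift : ∀ x y ys → excess x ys ≡ excess y ys + (+ x - + y) * ∑ ys pos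
excess-shift x y ys =
  trans (∑-cong ys λ z → regroup (+ x) (+ y) (+ z))
    (trans (∑-+ ys (λ z → + y * + z - + z * + z) (λ z → (+ x - + y) * + z))
           (cong (_+_ (excess y ys)) (∑-*ˡ ys (+ x - + y) pos)))
  where
  regroup : ∀ x y z → x * z - z * z ≡ y * z - z * z + (x - y) * z
  regroup = solve-∀

-- Raising every factor i by `c` adds `c` times the sum of (r_i - r_{i+1}) times the sum of all r_j
-- with j > i. That sum telescopes to `excess x ys`.
shiftedYoungSum-∷ : ∀ c x ys → shiftedYoungSum c (x ∷ ys) ≡
                    pairSum pos (x ∷ ys) + + c * excess x ys
shiftedYoungSum-∷ c x []       = sym (trans (+-identityˡ (+ c * + 0)) (*-zeroʳ (+ c)))
shiftedYoungSum-∷ c x (y ∷ ys) = begin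
  ∑< (length (y ∷ ys)) (λ s → (+ x - + y) * + (c ℕ.+ 1) * + at (y ∷ ys) (suc s)) + tail
    ≡⟨ cong₂ _+_ (trans (∑<-*ˡ (length (y ∷ ys)) ((+ x - + y) * + (c ℕ.+ 1)) (λ s → + at (y ∷ ys) (suc s)))
                        (cong ((+ x - + y) * + (c ℕ.+ 1) *_) (∑<-at (y ∷ ys))))
                 (∑<-cong (length ys) λ t → ∑<-cong (length (y ∷ ys) ∸ suc t) λ s →
                    cong (λ i → (+ at (y ∷ ys) (suc t) - + at (y ∷ ys) (suc (suc t))) * + i
                                * + at (y ∷ ys) (suc (suc t ℕ.+ s)))
                         (ℕₚ.+-suc c (suc t))) ⟩
  (+ x - + y) * + (c ℕ.+ 1) * ∑ (y ∷ ys) pos + shiftedYoungSum (suc c) (y ∷ ys)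
    ≡⟨ cong₂ (λ s t → (+ x - + y) * + s * ∑ (y ∷ ys) pos + t) (ℕₚ.+-comm c 1) (shiftedYoungSum-∷ (suc c) y ys) ⟩
  (+ x - + y) * + suc c * ∑ (y ∷ ys) pos + (pairSum pos (y ∷ ys) + + suc c * excess y ys)
    ≡⟨ regroup (+ x) (+ y) (+ c) (∑ (y ∷ ys) pos) (pairSum pos (y ∷ ys)) (excess y ys) ⟩
  -- The head of `y ∷ ys` adds y² - y² = 0 to `excess y ys`, so `excess-shift` can be used on the
  -- whole tail.
  (excess y (y ∷ ys) + (+ x - + y) * ∑ (y ∷ ys) pos) + pairSum pos (y ∷ ys)
    + + c * (excess y (y ∷ ys) + (+ x - + y) * ∑ (y ∷ ys) pos)
    ≡⟨ cong (λ t → t + pairSum pos (y ∷ ys) + + c * t) (sym (excess-shift x y (y ∷ ys))) ⟩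
  pairSum pos (x ∷ y ∷ ys) + + c * excess x (y ∷ ys) ∎
  where
  open ≡-Reasoning
  tail = ∑< (length ys) λ t → ∑< (length (y ∷ ys) ∸ suc t) λ s →
    (+ at (y ∷ ys) (suc t) - + at (y ∷ ys) (suc (suc t))) * + (c ℕ.+ suc (suc t))
    * + at (y ∷ ys) (suc (suc t ℕ.+ s))
  regroup : ∀ x y c S p q → (x - y) * (+ 1 + c) * S + (p + (+ 1 + c) * q) ≡
            (y * y - y * y + q + (x - y) * S) + p + c * (y * y - y * y + q + (x - y) * S)
  regroup = solve-∀

youngSum-pairSum : ∀ r → youngSum r ≡ pairSum pos r
youngSum-pairSum r = trans (to-∑< r) (unshifted r)
  where
  to-∑< : ∀ r → youngSum r ≡ shiftedYoungSum 0 r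
  to-∑< r = trans (sumFromTo-∑< 1 (length r ∸ 1) (λ i → sumFromTo (suc i) (length r) (term i)))
    (∑<-cong (length r ∸ 1) λ t → sumFromTo-∑< (suc (suc t)) (length r) (term (suc t)))
    where
    term : ℕ → ℕ → ℤ
    term i j = (+ at r i - + at r (suc i)) * + i * + at r j
  unshifted : ∀ r → shiftedYoungSum 0 r ≡ pairSum pos r
  unshifted []       = refl
  unshifted (x ∷ ys) = trans (shiftedYoungSum-∷ 0 x ys) (+-identityʳ (pairSum pos (x ∷ ys)))

pairSum-map : ∀ (f : A → ℕ) xs → pairSum pos (map f xs) ≡ pairSum (pos ∘ f) xs
pairSum-map f []       = refl
pairSum-map f (x ∷ xs) = cong₂ _+_ (∑-map f xs (λ y → + f x * + y - + y * + y)) (pairSum-map f xs)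

pairSum-cong-All : ∀ {f g : A → ℤ} {xs} → All (λ x → f x ≡ g x) xs → pairSum f xs ≡ pairSum g xs
pairSum-cong-All []              = refl
pairSum-cong-All {f = f} {g} (_∷_ {x} p ps) =
  cong₂ _+_ (row ps) (pairSum-cong-All ps)
  where
  row : ∀ {ys} → All (λ y → f y ≡ g y) ys →
        ∑ ys (λ y → f x * f y - f y * f y) ≡ ∑ ys (λ y → g x * g y - g y * g y)
  row []       = refl
  row (q ∷ qs) = cong₂ _+_ (cong₂ _-_ (cong₂ _*_ p q) (cong₂ _*_ q q)) (row qs)

-- Difference graphs

indicator : Bool → ℤ
indicator b = if b then + 1 else + 0

indicator² : ∀ b → indicator b * indicator b ≡ indicator b
indicator² true  = refl
indicator² false = refl

∑-filterᵇ : ∀ (p : A → Bool) xs (f : A → ℤ) → ∑ (filterᵇ p xs) f ≡ ∑ xs (λ x → indicator (p x) * f x)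
∑-filterᵇ p []       f = refl
∑-filterᵇ p (x ∷ xs) f with p x
... | true  = cong₂ _+_ (sym (*-identityˡ (f x))) (∑-filterᵇ p xs f)
... | false = trans (∑-filterᵇ p xs f) (sym (+-identityˡ _))

∑-concatMap : ∀ (g : A → List B) xs (f : B → ℤ) → ∑ (concatMap g xs) f ≡ ∑ xs (λ x → ∑ (g x) f)
∑-concatMap g []       f = refl
∑-concatMap g (x ∷ xs) f =
  trans (∑-++ (g x) (concatMap g xs) f) (cong (_+_ (∑ (g x) f)) (∑-concatMap g xs f))

∑-allFin-suc : ∀ n (f : Fin (suc n) → ℤ) → ∑ (tabulate Fin.suc) f ≡ ∑ (allFin n) (f ∘ Fin.suc)
∑-allFin-suc n f =
  trans (cong (λ xs → ∑ xs f) (sym (map-tabulate id Fin.suc))) (∑-map Fin.suc (allFin n) f)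

∑-indicator-≟ : ∀ {k} (j : Fin k) → ∑ (allFin k) (λ i → indicator ⌊ i ≟ j ⌋) ≡ + 1
∑-indicator-≟ {suc k} Fin.zero    =
  cong (_+_ (+ 1)) (trans (∑-allFin-suc k (λ i → indicator ⌊ i ≟ Fin.zero ⌋))
                          (∑-zero (allFin k) λ _ → refl))
∑-indicator-≟ {suc k} (Fin.suc j) =
  trans (+-identityˡ _)
    (trans (∑-allFin-suc k (λ i → indicator ⌊ i ≟ Fin.suc j ⌋))
      (trans (∑-cong (allFin k) suc-≟) (∑-indicator-≟ j)))
  where
  suc-≟ : ∀ i → indicator ⌊ Fin.suc i ≟ Fin.suc j ⌋ ≡ indicator ⌊ i ≟ j ⌋
  suc-≟ i with i ≟ j
  ... | yes _ = refl
  ... | no  _ = refl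

pos-sum : ∀ (f : A → ℕ) xs → pos (ListAction.sum (map f xs)) ≡ ∑ xs (pos ∘ f)
pos-sum f []       = refl
pos-sum f (x ∷ xs) = cong (_+_ (pos (f x))) (pos-sum f xs)

AllPairs-All : ∀ {P : A → Set} {R : A → A → Set} → (∀ {x y} → P x → P y → R x y) →
               ∀ {xs} → All P xs → AllPairs R xs
AllPairs-All h []         = []
AllPairs-All h (px ∷ pxs) = All.map (h px) pxs ∷ AllPairs-All h pxs

-- The characteristic polynomial is `mixedDet` with no vertex yet in the minor. For n < t the zero
-- value in `coeffA` matches the absence of `t`-element sublists.
coeffA-choose : ∀ t n adj → coeffA t n adj ≡
                choose t (Minors.minor (λ u v → - adjMatrix n adj u v) ∘ Vec.toList) (allFin n)
coeffA-choose t n adj with t ≤ᵇ n in eq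
... | true  =
  trans (det-coeff n _ id id (λ _ _ → refl) (n ∸ t))
    (trans (cong (λ R → D R (allFin n) (n ∸ t)) (sym (map-tabulate id marked)))
      (mixedDet-choose t [] (allFin n) (n ∸ t) (allFin⁺ n) (All.universal (λ _ → []) (allFin n))
        (trans (ℕₚ.m∸n+n≡m (ℕₚ.≤ᵇ⇒≤ t n (subst T (sym eq) tt))) (sym (length-tabulate {n = n} id)))))
  where open Minors (λ u v → - adjMatrix n adj u v)
... | false =
  sym (choose-short t _ (allFin n)
    (subst (ℕ._< t) (sym (length-tabulate {n = n} id)) (ℕₚ.≰⇒> λ t≤n → subst T eq (ℕₚ.≤⇒≤ᵇ t≤n))))

module DifferenceGraph (k n : ℕ) (part : Fin n → Fin k ⊎ Fin k) where

  V : Set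
  V = Fin n

  vertices : List V
  vertices = allFin n

  adj : V → V → Bool
  adj = diffAdj k n part

  -- `diffAdj` inspects `part` through a `with`. As a function of the two blocks alone, adjacency
  -- can be analysed by plain pattern matching.
  partAdj : Fin k ⊎ Fin k → Fin k ⊎ Fin k → Bool
  partAdj (inj₁ i) (inj₂ j) = (toℕ i ℕ.+ toℕ j) <ᵇ k
  partAdj (inj₂ j) (inj₁ i) = (toℕ i ℕ.+ toℕ j) <ᵇ k
  partAdj _        _        = false

  diffAdj-part : ∀ u v → adj u v ≡ partAdj (part u) (part v)
  diffAdj-part u v with part u | part v
  ... | inj₁ _ | inj₁ _ = refl
  ... | inj₁ _ | inj₂ _ = refl
  ... | inj₂ _ | inj₁ _ = refl
  ... | inj₂ _ | inj₂ _ = refl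

  a : V → V → ℤ
  a = adjMatrix n adj

  a-part : ∀ u v → a u v ≡ indicator (partAdj (part u) (part v))
  a-part u v = cong indicator (diffAdj-part u v)

  a-sym : ∀ u v → a u v ≡ a v u
  a-sym u v = trans (a-part u v) (trans (cong indicator (symmetric (part u) (part v))) (sym (a-part v u)))
    where
    symmetric : ∀ p q → partAdj p q ≡ partAdj q p
    symmetric (inj₁ _) (inj₁ _) = refl
    symmetric (inj₁ _) (inj₂ _) = refl
    symmetric (inj₂ _) (inj₁ _) = refl
    symmetric (inj₂ _) (inj₂ _) = refl

  a-hollow : ∀ u → a u u ≡ + 0
  a-hollow u = trans (a-part u u) (cong indicator (hollow (part u)))
    where
    hollow : ∀ p → partAdj p p ≡ false
    hollow (inj₁ _) = refl
    hollow (inj₂ _) = refl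

  a² : ∀ u v → a u v * a u v ≡ a u v
  a² u v = indicator² (adj u v)

  isX isY : Fin k ⊎ Fin k → ℤ
  isX (inj₁ _) = + 1
  isX (inj₂ _) = + 0
  isY (inj₁ _) = + 0
  isY (inj₂ _) = + 1

  χ ψ : V → ℤ
  χ = isX ∘ part
  ψ = isY ∘ part

  χ+ψ : ∀ u → χ u + ψ u ≡ + 1
  χ+ψ u with part u
  ... | inj₁ _ = refl
  ... | inj₂ _ = refl

  χ² : ∀ u → χ u * χ u ≡ χ u
  χ² u with part u
  ... | inj₁ _ = refl
  ... | inj₂ _ = refl

  ψχ : ∀ u v → ψ u * a u v ≡ χ v * a u v
  ψχ u v = trans (cong (ψ u *_) (a-part u v)) (trans (bipartite (part u) (part v)) (cong (χ v *_) (sym (a-part u v))))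
    where
    bipartite : ∀ p q → isY p * indicator (partAdj p q) ≡ isX q * indicator (partAdj p q)
    bipartite (inj₁ _) (inj₁ _) = refl
    bipartite (inj₁ i) (inj₂ j) = refl
    bipartite (inj₂ _) (inj₁ _) = refl
    bipartite (inj₂ _) (inj₂ _) = refl

  open Bipartite vertices a a-sym χ ψ χ+ψ χ² ψχ

  -- Exchanging the two sums weights each vertex by the number of blocks that contain it, which is
  -- one on its own side and zero on the other.
  ∑-blocks : ∀ (inBlock : Fin k → Fin k ⊎ Fin k → Bool) (f : V → ℤ) →
             ∑ (concatMap (λ i → filterᵇ (λ v → inBlock i (part v)) (allFin n)) (allFin k)) f ≡
             ∑ vertices (λ v → ∑ (allFin k) (λ i → indicator (inBlock i (part v))) * f v)
  ∑-blocks inBlock f =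
    trans (∑-concatMap (λ i → filterᵇ (λ v → inBlock i (part v)) (allFin n)) (allFin k) f)
      (trans (∑-cong (allFin k) λ i → ∑-filterᵇ (λ v → inBlock i (part v)) vertices f)
        (trans (∑-swap (allFin k) vertices λ i v → indicator (inBlock i (part v)) * f v)
               (∑-cong vertices λ v → ∑-*ʳ (allFin k) (λ i → indicator (inBlock i (part v))) (f v))))

  X Y : List V
  X = xList k n part
  Y = yList k n part

  ∑-X : ∀ f → ∑ X f ≡ ∑ vertices (λ v → χ v * f v)
  ∑-X f = trans (∑-blocks inBlockX f) (∑-cong vertices λ v → cong (_* f v) (once (part v)))
    where
    once : ∀ p → ∑ (allFin k) (λ i → indicator (inBlockX i p)) ≡ isX p
    once (inj₁ i) = ∑-indicator-≟ i
    once (inj₂ _) = ∑-zero (allFin k) λ _ → refl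

  ∑-Y : ∀ f → ∑ Y f ≡ ∑ vertices (λ v → ψ v * f v)
  ∑-Y f = trans (∑-blocks inBlockY f) (∑-cong vertices λ v → cong (_* f v) (once (part v)))
    where
    once : ∀ p → ∑ (allFin k) (λ i → indicator (inBlockY i p)) ≡ isY p
    once (inj₁ _) = ∑-zero (allFin k) λ _ → refl
    once (inj₂ i) = ∑-indicator-≟ i

  xBlock : Fin k → List V
  xBlock i = filterᵇ (λ v → inBlockX i (part v)) (allFin n)

  xBlock-part : ∀ i → All (λ v → part v ≡ inj₁ i) (xBlock i)
  xBlock-part i = All.map (λ {v} → sound (part v)) (Allₚ.all-filter (λ v → T? (inBlockX i (part v))) (allFin n))
    where
    sound : ∀ p → T (inBlockX i p) → p ≡ inj₁ i
    sound (inj₁ j) t with i ≟ j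
    ... | yes i≡j = cong inj₁ (sym i≡j)
    sound (inj₁ j) () | no _

  X-coloured : All (λ v → χ v ≡ + 1) X
  X-coloured =
    Allₚ.concat⁺ (Allₚ.map⁺ (All.universal (λ i → All.map (cong isX) (xBlock-part i)) (allFin k)))

  -- Inclusion of the neighbourhood of `y` in that of `x`, written with indicators so that summation
  -- over `v` turns it into `common x y ≡ degree y`.
  Dominates : V → V → Set
  Dominates x y = ∀ v → a x v * a y v ≡ a y v

  dominates : ∀ {x y i j} → toℕ i ≤ toℕ j → part x ≡ inj₁ i → part y ≡ inj₁ j → Dominates x y
  dominates {x} {y} {i} {j} i≤j px py v =
    trans (cong₂ _*_ (a-row px) (a-row py)) (trans (nested (part v)) (sym (a-row py)))
    where
    a-row : ∀ {u l} → part u ≡ inj₁ l → a u v ≡ indicator (partAdj (inj₁ l) (part v))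
    a-row {u} p = trans (a-part u v) (cong (λ q → indicator (partAdj q (part v))) p)
    nested : ∀ q → indicator (partAdj (inj₁ i) q) * indicator (partAdj (inj₁ j) q) ≡
                   indicator (partAdj (inj₁ j) q)
    nested (inj₁ _) = refl
    nested (inj₂ l) with (toℕ j ℕ.+ toℕ l) <ᵇ k in eq
    ... | false = *-zeroʳ (indicator ((toℕ i ℕ.+ toℕ l) <ᵇ k))
    ... | true with (toℕ i ℕ.+ toℕ l) <ᵇ k in eq′
    ...   | true  = refl
    -- Impossible: i + l ≤ j + l < k.
    ...   | false = contradiction (subst T eq′ (ℕₚ.<⇒<ᵇ
                      (ℕₚ.≤-<-trans (ℕₚ.+-monoˡ-≤ (toℕ l) i≤j) (ℕₚ.<ᵇ⇒< _ k (subst T (sym eq) tt))))) λ ()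

  -- `X` lists its blocks by increasing index. Vertices of one block have equal neighbourhoods, and
  -- a later block has a smaller one.
  X-nested : AllPairs Dominates X
  X-nested = AllPairsₚ.concat⁺
    (Allₚ.map⁺ (All.universal (λ i → AllPairs-All (dominates {i = i} {i} ℕₚ.≤-refl) (xBlock-part i)) (allFin k)))
    (AllPairsₚ.map⁺ (AllPairsₚ.tabulate⁺-< λ {i} {j} i<j →
      All.map (λ px → All.map (dominates (ℕₚ.<⇒≤ i<j) px) (xBlock-part j)) (xBlock-part i)))

  -- A vertex of `X` has all its neighbours in `Y`, so the columns of the Young matrix account for
  -- its whole degree.
  rowSum-degree : All (λ x → pos (ListAction.sum (map (λ y → if adj x y then 1 else 0) Y)) ≡ degree x) X
  rowSum-degree = All.map (λ {x} → row x) X-coloured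
    where
    open ≡-Reasoning
    pos-if : ∀ b → pos (if b then 1 else 0) ≡ indicator b
    pos-if true  = refl
    pos-if false = refl
    row : ∀ x → χ x ≡ + 1 → pos (ListAction.sum (map (λ y → if adj x y then 1 else 0) Y)) ≡ degree x
    row x χx = begin
      pos (ListAction.sum (map (λ y → if adj x y then 1 else 0) Y))
        ≡⟨ pos-sum (λ y → if adj x y then 1 else 0) Y ⟩
      ∑ Y (λ y → pos (if adj x y then 1 else 0))
        ≡⟨ ∑-cong Y (λ y → pos-if (adj x y)) ⟩
      ∑ Y (a x)
        ≡⟨ ∑-Y (a x) ⟩
      ∑ vertices (λ v → ψ v * a x v)
        ≡⟨ ∑-cong vertices (λ v → trans (cong (ψ v *_) (a-sym x v))
             (trans (ψχ v x) (trans (cong₂ _*_ χx (a-sym v x)) (*-identityˡ (a x v))))) ⟩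
      degree x ∎

  youngSum-degree : youngSum (rowSums k n part) ≡ pairSum degree X
  youngSum-degree =
    trans (youngSum-pairSum (rowSums k n part))
      (trans (cong (pairSum pos) (sym (map-∘ X)))
        (trans (pairSum-map (λ x → ListAction.sum (map (λ y → if adj x y then 1 else 0) Y)) X)
               (pairSum-cong-All rowSum-degree)))

  -- The part of λI - A free of λ. The sign disappears later because only products of two or four
  -- entries occur.
  e : V → V → ℤ
  e u v = - a u v

  e-sym : ∀ u v → e u v ≡ e v u
  e-sym u v = cong -_ (a-sym u v)

  e-hollow : ∀ u → e u u ≡ + 0
  e-hollow u = cong -_ (a-hollow u)

  pairs-of-X : + 12 * (∑ X degree * ∑ X degree - ∑ X (λ x → ∑ X λ y → common x y * common x y)) ≡
               + 24 * pairSum degree X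
  pairs-of-X =
    trans (cong (+ 12 *_) (nested-rows degree common
             (λ x → ∑-cong vertices (a² x))
             (λ x y → ∑-cong vertices λ v → *-comm (a x v) (a y v))
             (AllPairs.map (∑-cong vertices) X-nested)))
          (twelve (pairSum degree X))
    where
    twelve : ∀ p → + 12 * (+ 2 * p) ≡ + 24 * p
    twelve = solve-∀

  choose₄-minors : + 24 * choose 4 (Minors.minor e ∘ Vec.toList) vertices ≡ + 24 * pairSum degree X
  choose₄-minors = begin
    + 24 * choose 4 (Minors.minor e ∘ Vec.toList) vertices
      ≡⟨ cong (+ 24 *_) (choose-cong 4 vertices
           λ { (a ∷ b ∷ c ∷ d ∷ []) → minor₄ e e-hollow e-sym a b c d }) ⟩
    + 24 * choose 4 (uncurry₄ (minorForm e)) vertices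
      -- Here `4 !` computes to 24.
      ≡⟨ sym (full-choose 4 vertices (minorForm-hollowSymmetric e e-hollow e-sym)) ⟩
    ∑⁴ vertices (minorForm e)
      ≡⟨ ∑⁴-minorForm vertices e e-sym ⟩
    + 3 * (∑ vertices (λ u → ∑ vertices λ v → e u v * e u v) * ∑ vertices (λ u → ∑ vertices λ v → e u v * e u v))
      - + 6 * ∑⁴ vertices (closedWalk e)
      ≡⟨ cong₂ (λ s t → + 3 * (s * s) - + 6 * t) squares walks ⟩
    + 3 * (+ 2 * R * (+ 2 * R)) - + 6 * (+ 2 * M)
      -- Each trace is twice a sum over `X`, so 3 · 2² and 6 · 2 both become 12; the remaining
      -- factor 2 of 24 comes from unordered pairs.
      ≡⟨ factor R M ⟩
    + 12 * (R * R - M)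
      ≡⟨ pairs-of-X ⟩
    + 24 * pairSum degree X ∎
    where
    open ≡-Reasoning
    R = ∑ X degree
    M = ∑ X (λ x → ∑ X λ y → common x y * common x y)
    neg² : ∀ p → - p * - p ≡ p * p
    neg² = solve-∀
    neg⁴ : ∀ p q r s → - p * - q * (- r * - s) ≡ p * q * (r * s)
    neg⁴ = solve-∀
    squares : ∑ vertices (λ u → ∑ vertices λ v → e u v * e u v) ≡ + 2 * R
    squares = trans (∑-cong vertices λ u → ∑-cong vertices λ v → trans (neg² (a u v)) (a² u v))
                    (trans ∑-degree (cong (+ 2 *_) (sym (∑-X degree))))
    walks : ∑⁴ vertices (closedWalk e) ≡ + 2 * M
    walks =
      trans (∑⁴-cong vertices λ u v w z → neg⁴ (a u v) (a v w) (a w z) (a z u))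
        (trans ∑⁴-walk (cong (+ 2 *_)
          (trans (∑-cong vertices λ u → cong (χ u *_) (sym (∑-X λ w → common u w * common u w)))
                 (sym (∑-X λ u → ∑ X λ w → common u w * common u w)))))
    factor : ∀ r m → + 3 * (+ 2 * r * (+ 2 * r)) - + 6 * (+ 2 * m) ≡ + 12 * (r * r - m)
    factor = solve-∀

theorem6p1 : (k n : ℕ) → 1 ≤ k → (part : Fin n → Fin k ⊎ Fin k)
    → (∀ p → ∃ λ v → part v ≡ p)
    → coeffA 4 n (diffAdj k n part) ≡ youngSum (rowSums k n part)
theorem6p1 k n _ part _ =
  trans (coeffA-choose 4 n (diffAdj k n part))
    (trans (*-cancelˡ-≡ (+ 24) _ _ choose₄-minors) (sym youngSum-degree))
  where open DifferenceGraph k n part
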